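{- Let $H_n$ be the pyrene system with $n$ pyrene fragments, and let $F(H_0,x)=1$. Then $F(H_1,x)=4x^2+2x$ and for all $n\ge 2$, $$F(H_n,x)=(4x^2+2x)F(H_{n-1},x)-x^2F(H_{n-2},x).$$
   Context: Pyrene system: draw the hexagonal lattice so that every hexagon has two vertical sides; horizontally adjacent hexagons then share a vertical edge. For $n\ge1$, $H_n$ is the hexagonal system (the plane graph formed by the vertices and edges of the following $4n$ hexagons) consisting of a horizontal linear row of $2n$ hexagons $h_{1,1},h_{1,2},\dots,h_{n,1},h_{n,2}$, consecutive ones sharing a vertical edge, together with, for each $i$, a hexagon $s_{i,1}$ directly above and a hexagon $s_{i,2}$ directly below the common edge of $h_{i,1}$ and $h_{i,2}$ (each sharing an edge with both $h_{i,1}$ and $h_{i,2}$). $H_0$ is the null graph. For a perfect matching $M$ of $G$, a forcing set is a subset $S\subseteq M$ contained in no other perfect matching of $G$, and the forcing number $f(G,M)$ is the minimum size of a forcing set. The forcing polynomial is $F(G,x)=\sum_{M\in\mathcal{M}(G)}x^{f(G,M)}$, where $\mathcal{M}(G)$ is the set of perfect matchings of $G$. -}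

module Defs where

open import Data.Integer.Base as ℤ using (ℤ; 0ℤ; 1ℤ)
open import Data.List.Base using (List; []; _∷_; _++_; [_]; map; foldr; length; filter; replicate; concatMap; upTo; deduplicate)
open import Data.List.Extrema.Nat using (min)
import Data.List.Properties as List
open import Data.List.Relation.Unary.All as All using (All)
import Data.List.Relation.Binary.Subset.DecPropositional as DecSubset
open import Data.List.Relation.Unary.Unique.Propositional using (Unique)
import Data.List.Relation.Unary.Unique.DecPropositional.Properties as DecUnique
open import Data.Nat.Base as ℕ using (ℕ; zero; suc)
import Data.Nat.Properties as ℕ
open import Data.Product.Base using (_×_; _,_; proj₁; proj₂)
import Data.Product.Properties as Product
open import Data.Sum.Base using (_⊎_)
open import Relation.Binary.Definitions using (DecidableEquality)
open import Relation.Binary.PropositionalEquality using (_≡_)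
open import Relation.Nullary.Decidable using (Dec; _⊎-dec_; _→-dec_)

------------------------------------------------------------------------
-- Polynomials over ℤ

-- a₀ ∷ a₁ ∷ … ∷ aₘ ∷ [] stands for a₀ + a₁ x + … + aₘ xᵐ.  Trailing
-- zeros are allowed, so equality of polynomials is _≈_ and not _≡_.
Poly : Set
Poly = List ℤ

coeff : Poly → ℕ → ℤ
coeff []      _       = 0ℤ
coeff (a ∷ p) zero    = a
coeff (a ∷ p) (suc k) = coeff p k

infix  4 _≈_
infixl 6 _⊕_ _⊖_
infixl 7 _⊗_
infixr 7 _·_

_≈_ : Poly → Poly → Set
p ≈ q = ∀ k → coeff p k ≡ coeff q k

_⊕_ : Poly → Poly → Poly
[]      ⊕ q       = q
(a ∷ p) ⊕ []      = a ∷ p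
(a ∷ p) ⊕ (b ∷ q) = (a ℤ.+ b) ∷ (p ⊕ q)

_·_ : ℤ → Poly → Poly
c · p = map (c ℤ.*_) p

_⊖_ : Poly → Poly → Poly
p ⊖ q = p ⊕ map ℤ.-_ q

_⊗_ : Poly → Poly → Poly
[]      ⊗ q = []
(a ∷ p) ⊗ q = (a · q) ⊕ (0ℤ ∷ (p ⊗ q))

x^_ : ℕ → Poly
x^ k = replicate k 0ℤ ++ [ 1ℤ ]

------------------------------------------------------------------------
-- Perfect matchings and forcing

-- Each edge is listed once, as one ordered pair of its two ends.
record Graph (V : Set) : Set where
  field
    vertices : List V
    edges    : List (V × V)
    edges!   : Unique edges

-- For a duplicate-free list xs, every subset of xs occurs exactly once,
-- as a list in the order of xs.
subsets : ∀ {A : Set} → List A → List (List A)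
subsets []       = [ [] ]
subsets (x ∷ xs) = map (x ∷_) (subsets xs) ++ subsets xs

module Forcing {V : Set} (_≟_ : DecidableEquality V) (G : Graph V) where

  open Graph G

  Edge : Set
  Edge = V × V

  _≟ᴱ_ : DecidableEquality Edge
  _≟ᴱ_ = Product.≡-dec _≟_ _≟_

  open DecSubset _≟ᴱ_ using (_⊆_; _⊆?_)

  Incident : V → Edge → Set
  Incident v e = v ≡ proj₁ e ⊎ v ≡ proj₂ e

  incident? : ∀ v e → Dec (Incident v e)
  incident? v e = (v ≟ proj₁ e) ⊎-dec (v ≟ proj₂ e)

  IsPerfect : List Edge → Set
  IsPerfect M = All (λ v → length (filter (incident? v) M) ≡ 1) vertices

  isPerfect? : ∀ M → Dec (IsPerfect M)
  isPerfect? M = All.all? (λ v → length (filter (incident? v) M) ℕ.≟ 1) vertices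

  perfectMatchings : List (List Edge)
  perfectMatchings = filter isPerfect? (subsets edges)

  -- Perfect matchings are listed in the order of edges, so M′ ≡ M says
  -- that they are equal as sets.
  IsForcing : List Edge → List Edge → Set
  IsForcing M S = All (λ M′ → S ⊆ M′ → M′ ≡ M) perfectMatchings

  isForcing? : ∀ M S → Dec (IsForcing M S)
  isForcing? M S =
    All.all? (λ M′ → (S ⊆? M′) →-dec List.≡-dec _≟ᴱ_ M′ M) perfectMatchings

  forcingSets : List Edge → List (List Edge)
  forcingSets M = filter (isForcing? M) (subsets M)

  -- The default value length M of min does not affect the minimum: a
  -- perfect matching M is itself a forcing set of M.
  forcingNumber : List Edge → ℕ
  forcingNumber M = min (length M) (map length (forcingSets M))

  forcingPolynomial : Poly
  forcingPolynomial =
    foldr _⊕_ [] (map (λ M → x^ (forcingNumber M)) perfectMatchings)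

------------------------------------------------------------------------
-- Hexagonal systems

-- The hexagonal lattice in brick-wall coordinates: (a , b) is joined to
-- (a + 1 , b) always, and to (a , b + 1) iff a + b is even.
Point : Set
Point = ℕ × ℕ

_≟ᴾ_ : DecidableEquality Point
_≟ᴾ_ = Product.≡-dec ℕ._≟_ ℕ._≟_

-- A hexagon is named by its lower left corner (a , b), with a + b even;
-- (1 + a , b) is its lowest and (1 + a , 1 + b) its highest vertex:
--
--   (a , 1+b) ── (1+a , 1+b) ── (2+a , 1+b)
--       │                            │
--    (a , b)  ──  (1+a , b)  ──  (2+a , b)
--
-- The hexagon to the right is (2 + a , b); above and below the edge shared
-- with it lie the hexagons (1 + a , 1 + b) and (1 + a , b - 1).
hexagonVertices : Point → List Point
hexagonVertices (a , b) =
  (a , b)     ∷ (1 ℕ.+ a , b)       ∷ (2 ℕ.+ a , b)       ∷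
  (a , suc b) ∷ (1 ℕ.+ a , suc b)   ∷ (2 ℕ.+ a , suc b)   ∷ []

-- Every edge points right or up, so an edge shared by two hexagons is the
-- same pair in both.
hexagonEdges : Point → List (Point × Point)
hexagonEdges (a , b) =
  ((a , b)           , (1 ℕ.+ a , b))     ∷
  ((1 ℕ.+ a , b)     , (2 ℕ.+ a , b))     ∷
  ((a , suc b)       , (1 ℕ.+ a , suc b)) ∷
  ((1 ℕ.+ a , suc b) , (2 ℕ.+ a , suc b)) ∷
  ((a , b)           , (a , suc b))       ∷
  ((2 ℕ.+ a , b)     , (2 ℕ.+ a , suc b)) ∷ []

hexagonalSystem : List Point → Graph Point
hexagonalSystem hs = record
  { vertices = deduplicate _≟ᴾ_ (concatMap hexagonVertices hs)
  ; edges    = deduplicate _≟ᴮ_ (concatMap hexagonEdges hs)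
  ; edges!   = DecUnique.deduplicate-! _≟ᴮ_ (concatMap hexagonEdges hs)
  }
  where
  _≟ᴮ_ : DecidableEquality (Point × Point)
  _≟ᴮ_ = Product.≡-dec _≟ᴾ_ _≟ᴾ_

-- The hexagons h₁, h₂, s₁, s₂ (in this order) of fragment i, counted from 0.
pyreneFragment : ℕ → List Point
pyreneFragment i =
  (1 ℕ.+ 4 ℕ.* i , 1) ∷ (3 ℕ.+ 4 ℕ.* i , 1) ∷
  (2 ℕ.+ 4 ℕ.* i , 2) ∷ (2 ℕ.+ 4 ℕ.* i , 0) ∷ []

H : ℕ → Graph Point
H n = hexagonalSystem (concatMap pyreneFragment (upTo n))

F : Graph Point → Poly
F = Forcing.forcingPolynomial _≟ᴾ_

{-# OPTIONS --safe #-}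
module Submission where

-- A perfect matching of H n is a word of length n over six letters, one per
-- fragment.  Either the middle edge of the fragment is unmatched, and the
-- hexagons above and below it are alternating, in one of 2 × 2 ways; or the
-- middle edge is matched, and the fragment sends one edge of its upper and
-- one of its lower half to its left, or to its right, neighbouring shared
-- vertical edge.  That upper and lower half choose the same direction is
-- seen by going through the fragments from left to right.  The only
-- forbidden factor is "right, left", where both fragments would use the same
-- shared edge.  The first kind of letter carries two alternating hexagons
-- and the second kind one, all of them disjoint, and as many edges determine
-- the letters; so the forcing number is 2 and 1 per letter, respectively.
-- Words avoiding "right, left" with these weights satisfy the recurrence.

open import Defs
open import Data.Bool.Base using (Bool; true; false; not; _∧_)
open import Data.Bool.Properties using (∧-zeroʳ; ¬-not) renaming (_≟_ to _≟ᵇ_)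
open import Data.Fin using (#_)
open import Data.Integer.Base as ℤ using (ℤ; +_; 0ℤ; 1ℤ)
import Data.Integer.Properties as ℤ
open import Data.Integer.Tactic.RingSolver using (solve-∀)
open import Data.List.Base using (List; []; _∷_; _++_; [_]; map; foldr; length; filter; replicate; concatMap; upTo)
open import Data.List.Extrema.Nat using (min≤v⁺; v≤min⁺)
open import Data.List.Membership.Propositional using (_∈_; find; lose)
open import Data.List.Membership.Propositional.Properties using (∈-map⁺; ∈-map⁻; ∈-++⁺ˡ; ∈-++⁺ʳ; ∈-++⁻; ∈-filter⁺; ∈-filter⁻; ∈-∃++; ∈-concatMap⁺; ∈-concatMap⁻; ∈-upTo⁺; ∈-upTo⁻; ∈-deduplicate⁺; ∈-deduplicate⁻; ∈-lookup)
open import Data.List.Membership.Propositional.Properties.WithK using (unique∧set⇒bag)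
open import Data.List.Properties using (length-map; length-++; map-∘; map-cong-local; ∷-injectiveˡ; ∷-injectiveʳ)
open import Data.List.Relation.Binary.BagAndSetEquality using (∼bag⇒↭)
open import Data.List.Relation.Binary.Disjoint.Propositional using (Disjoint)
open import Data.List.Relation.Binary.Permutation.Propositional as Perm using (_↭_)
open import Data.List.Relation.Binary.Permutation.Propositional.Properties using (↭-length) renaming (map⁺ to ↭-map⁺)
open import Data.List.Relation.Binary.Subset.Propositional using (_⊆_)
open import Data.List.Relation.Unary.All as All using (All; []; _∷_)
import Data.List.Relation.Unary.All.Properties as All
open import Data.List.Relation.Unary.AllPairs as AllPairs using ([]; _∷_)
import Data.List.Relation.Unary.AllPairs.Properties as AllPairs
open import Data.List.Relation.Unary.Any using (here; there)
open import Data.List.Relation.Unary.Unique.Propositional using (Unique)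
import Data.List.Relation.Unary.Unique.Propositional.Properties as Unique
open import Data.Nat.Base using (ℕ; zero; suc; _+_; _*_; _∸_; _≤_; _<_; z≤n; s≤s; s≤s⁻¹)
open import Data.Nat.Properties using (*-comm; +-comm; +-suc; ≤-trans; ≤-antisym; ≤-reflexive; n≤1+n)
open import Data.Product.Base using (∃; _×_; _,_; proj₁; proj₂; map₂)
open import Data.Sum.Base using (_⊎_; inj₁; inj₂)
open import Function.Base using (_∘_)
open import Function.Bundles using (mk⇔)
open import Relation.Binary.PropositionalEquality using (_≡_; _≢_; refl; sym; trans; cong; cong₂; subst)
open import Relation.Nullary.Decidable using (yes; no; does)
open import Relation.Nullary.Negation using (¬_; contradiction)
open import Relation.Unary using (Decidable)

data Side : Set where
  up low : Side

data Dir : Set where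
  left right : Dir

opposite : Dir → Dir
opposite left  = right
opposite right = left

_==_ : Dir → Dir → Bool
left  == left  = true
left  == right = false
right == left  = false
right == right = true

-- One half (upper or lower) of a fragment, in brick-wall coordinates
-- relative to the fragment:
--
--              corner left ─tip left─ top ─tip right─ corner right
--                  │                                      │
--              side left                             side right
--                  │                                      │
--   joint ─exit─ base left ─arm left─ mid ─arm right─ base right ─exit─ joint
--
-- The right joint is the left joint of the next fragment.
data Part : Set where
  exit arm side tip : Dir → Part

data Site : Set where
  joint mid top : Site
  base corner   : Dir → Site

-- middle and cut join the two mid sites, respectively the two (left)
-- joints, of the upper and the lower half.
data Loc : Set where
  half       : Side → Part → Loc
  middle cut : Loc

Label Node : Set
Label = ℕ × Loc
Node  = Side × Site × ℕ

star : Node → List Label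
star (σ , joint , zero)  = (zero , half σ (exit left)) ∷ (zero , cut) ∷ []
star (σ , joint , suc i) = (i , half σ (exit right)) ∷ (suc i , half σ (exit left)) ∷ (suc i , cut) ∷ []
star (σ , mid , i)       = (i , half σ (arm left)) ∷ (i , half σ (arm right)) ∷ (i , middle) ∷ []
star (σ , top , i)       = (i , half σ (tip left)) ∷ (i , half σ (tip right)) ∷ []
star (σ , base δ , i)    = (i , half σ (exit δ)) ∷ (i , half σ (arm δ)) ∷ (i , half σ (side δ)) ∷ []
star (σ , corner δ , i)  = (i , half σ (side δ)) ∷ (i , half σ (tip δ)) ∷ []

-- The cuts and joints of H n have indices 0, …, n; everything else has
-- indices 0, …, n - 1.
reach : Loc → ℕ
reach cut = 0
reach _   = 1

reachᴺ : Site → ℕ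
reachᴺ joint = 0
reachᴺ _     = 1

Within : ℕ → Label → Set
Within n (i , l) = i + reach l ≤ n

Withinᴺ : ℕ → Node → Set
Withinᴺ n (_ , s , i) = i + reachᴺ s ≤ n

next : Label → Label
next (i , l) = (suc i , l)

first : Loc → Label
first l = (0 , l)

countTrue : List Bool → ℕ
countTrue []           = 0
countTrue (true  ∷ bs) = suc (countTrue bs)
countTrue (false ∷ bs) = countTrue bs

-- r tells whether the joints at index 0 are covered from the left.
prior : Bool → Node → List Bool
prior r (_ , joint , zero) = [ r ]
prior r _                  = []

Exact : Bool → ℕ → (Label → Bool) → Set
Exact r n μ = ∀ ν → Withinᴺ n ν → countTrue (prior r ν ++ map μ (star ν)) ≡ 1

Supported : ℕ → (Label → Bool) → Set
Supported n μ = ∀ ε → μ ε ≡ true → Within n ε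

-- Words

data HalfState : Set where
  ring exits : Dir → HalfState

-- rings δ δ′ leaves the middle edge unmatched and matches arm δ above and
-- arm δ′ below; exits δ matches the middle edge and exit δ on both sides.
data Letter : Set where
  rings : Dir → Dir → Letter
  exits : Dir → Letter

Word : Set
Word = List Letter

halfValue : HalfState → Part → Bool
halfValue (ring  δ) (exit δ′) = false
halfValue (exits δ) (exit δ′) = δ == δ′
halfValue (ring  δ) (arm δ′)  = δ == δ′
halfValue (exits δ) (arm δ′)  = false
halfValue (ring  δ) (side δ′) = opposite δ == δ′
halfValue (exits δ) (side δ′) = opposite δ == δ′
halfValue (ring  δ) (tip δ′)  = δ == δ′
halfValue (exits δ) (tip δ′)  = δ == δ′

middleValue : HalfState → Bool
middleValue (ring  _) = false
middleValue (exits _) = true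

halfOf : Letter → Side → HalfState
halfOf (rings δ _) up  = ring δ
halfOf (rings _ δ) low = ring δ
halfOf (exits δ)   _   = exits δ

exitsTo : Dir → Letter → Bool
exitsTo δ (rings _ _) = false
exitsTo δ (exits δ′)  = δ′ == δ

-- The value at cut is junk: a cut depends on two letters.
value : Letter → Loc → Bool
value t (half σ p) = halfValue (halfOf t σ) p
value t middle     = middleValue (halfOf t up)
value t cut        = false

entersLeft : Word → Bool
entersLeft []      = false
entersLeft (t ∷ w) = exitsTo left t

mem : Bool → Word → Label → Bool
mem r w       (zero  , cut) = not r ∧ not (entersLeft w)
mem r []      (i     , l)   = false
mem r (t ∷ w) (zero  , l)   = value t l
mem r (t ∷ w) (suc i , l)   = mem (exitsTo right t) w (i , l)

data Admissible : Bool → ℕ → Word → Set where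
  []  : ∀ {r} → Admissible r 0 []
  _∷_ : ∀ {r n t w} → r ∧ exitsTo left t ≡ false →
        Admissible (exitsTo right t) n w → Admissible r (suc n) (t ∷ w)

halfExact : ∀ h →
  (∀ δ → countTrue (halfValue h (exit δ) ∷ halfValue h (arm δ) ∷ halfValue h (side δ) ∷ []) ≡ 1) ×
  (∀ δ → countTrue (halfValue h (side δ) ∷ halfValue h (tip δ) ∷ []) ≡ 1) ×
  countTrue (halfValue h (arm left) ∷ halfValue h (arm right) ∷ middleValue h ∷ []) ≡ 1 ×
  countTrue (halfValue h (tip left) ∷ halfValue h (tip right) ∷ []) ≡ 1
halfExact (ring left)   = (λ { left → refl ; right → refl }) , (λ { left → refl ; right → refl }) , refl , refl
halfExact (ring right)  = (λ { left → refl ; right → refl }) , (λ { left → refl ; right → refl }) , refl , refl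
halfExact (exits left)  = (λ { left → refl ; right → refl }) , (λ { left → refl ; right → refl }) , refl , refl
halfExact (exits right) = (λ { left → refl ; right → refl }) , (λ { left → refl ; right → refl }) , refl , refl

middle-halfOf : ∀ t σ → middleValue (halfOf t σ) ≡ middleValue (halfOf t up)
middle-halfOf t           up  = refl
middle-halfOf (rings _ _) low = refl
middle-halfOf (exits _)   low = refl

exit-halfOf : ∀ t σ δ → halfValue (halfOf t σ) (exit δ) ≡ exitsTo δ t
exit-halfOf (rings _ _) up  δ = refl
exit-halfOf (rings _ _) low δ = refl
exit-halfOf (exits _)   σ   δ = refl

countTrue-joint : ∀ r l → r ∧ l ≡ false → countTrue (r ∷ l ∷ (not r ∧ not l) ∷ []) ≡ 1
countTrue-joint false false _ = refl
countTrue-joint false true  _ = refl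
countTrue-joint true  false _ = refl

mem-exact : ∀ {r n w} → Admissible r n w → Exact r n (mem r w)
mem-exact {r} [] (σ , joint , zero) _ = countTrue-joint r false (∧-zeroʳ r)
mem-exact {r} (_∷_ {t = t} ok a) (σ , joint , zero) _ rewrite exit-halfOf t σ left =
  countTrue-joint r (exitsTo left t) ok
mem-exact (_∷_ {t = t} ok a) (σ , mid , zero) _ rewrite sym (middle-halfOf t σ) =
  proj₁ (proj₂ (proj₂ (halfExact (halfOf t σ))))
mem-exact (_∷_ {t = t} ok a) (σ , top , zero) _ =
  proj₂ (proj₂ (proj₂ (halfExact (halfOf t σ))))
mem-exact (_∷_ {t = t} ok a) (σ , base δ , zero) _ = proj₁ (halfExact (halfOf t σ)) δ
mem-exact (_∷_ {t = t} ok a) (σ , corner δ , zero) _ = proj₁ (proj₂ (halfExact (halfOf t σ))) δ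
mem-exact (_∷_ {t = t} ok a) (σ , joint , suc zero) (s≤s p) rewrite exit-halfOf t σ right =
  mem-exact a (σ , joint , zero) p
mem-exact (ok ∷ a) (σ , joint , suc (suc i)) (s≤s p) = mem-exact a (σ , joint , suc i) p
mem-exact (ok ∷ a) (σ , mid , suc i)         (s≤s p) = mem-exact a (σ , mid , i) p
mem-exact (ok ∷ a) (σ , top , suc i)         (s≤s p) = mem-exact a (σ , top , i) p
mem-exact (ok ∷ a) (σ , base δ , suc i)      (s≤s p) = mem-exact a (σ , base δ , i) p
mem-exact (ok ∷ a) (σ , corner δ , suc i)    (s≤s p) = mem-exact a (σ , corner δ , i) p

mem-supported : ∀ {r n w} → Admissible r n w → Supported n (mem r w)
mem-supported a        (zero , cut)      _ = z≤n
mem-supported (_ ∷ a)  (zero , half _ _) _ = s≤s z≤n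
mem-supported (_ ∷ a)  (zero , middle)   _ = s≤s z≤n
mem-supported (_ ∷ a)  (suc i , l)       e = s≤s (mem-supported a (i , l) e)

-- Reading off the word of a perfect matching

HalfTable : Set
HalfTable = (Bool × Bool) × (Bool × Bool) × (Bool × Bool) × (Bool × Bool) × Bool

halfTable : (Part → Bool) → Bool → HalfTable
halfTable f m =
  (f (side left) , f (side right)) , (f (tip left) , f (tip right)) ,
  (f (exit left) , f (exit right)) , (f (arm left) , f (arm right)) , m

solveHalf : ∀ sl tl tr sr el al ar er m →
  countTrue (sl ∷ tl ∷ []) ≡ 1 → countTrue (sr ∷ tr ∷ []) ≡ 1 → countTrue (tl ∷ tr ∷ []) ≡ 1 →
  countTrue (el ∷ al ∷ sl ∷ []) ≡ 1 → countTrue (er ∷ ar ∷ sr ∷ []) ≡ 1 → countTrue (al ∷ ar ∷ m ∷ []) ≡ 1 →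
  ∃ λ h → halfTable (halfValue h) (middleValue h) ≡ ((sl , sr) , (tl , tr) , (el , er) , (al , ar) , m)
solveHalf true  true  tr    sr    el    al    ar    er    m     () _ _ _ _ _
solveHalf true  false false sr    el    al    ar    er    m     _ _ () _ _ _
solveHalf true  false true  true  el    al    ar    er    m     _ () _ _ _ _
solveHalf true  false true  false true  true  ar    er    m     _ _ _ () _ _
solveHalf true  false true  false true  false ar    er    m     _ _ _ () _ _
solveHalf true  false true  false false true  ar    er    m     _ _ _ () _ _
solveHalf true  false true  false false false true  true  m     _ _ _ _ () _
solveHalf true  false true  false false false true  false true  _ _ _ _ _ ()
solveHalf true  false true  false false false true  false false _ _ _ _ _ _ = ring right , refl
solveHalf true  false true  false false false false false m     _ _ _ _ () _
solveHalf true  false true  false false false false true  false _ _ _ _ _ ()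
solveHalf true  false true  false false false false true  true  _ _ _ _ _ _ = exits right , refl
solveHalf false false tr    sr    el    al    ar    er    m     () _ _ _ _ _
solveHalf false true  true  sr    el    al    ar    er    m     _ _ () _ _ _
solveHalf false true  false false el    al    ar    er    m     _ () _ _ _ _
solveHalf false true  false true  el    al    true  true  m     _ _ _ _ () _
solveHalf false true  false true  el    al    true  false m     _ _ _ _ () _
solveHalf false true  false true  el    al    false true  m     _ _ _ _ () _
solveHalf false true  false true  true  true  false false m     _ _ _ () _ _
solveHalf false true  false true  false false false false m     _ _ _ () _ _
solveHalf false true  false true  false true  false false true  _ _ _ _ _ ()
solveHalf false true  false true  false true  false false false _ _ _ _ _ _ = ring left , refl
solveHalf false true  false true  true  false false false false _ _ _ _ _ ()
solveHalf false true  false true  true  false false false true  _ _ _ _ _ _ = exits left , refl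

module _ {r n μ} (exact : Exact r (suc n) μ) where

  private
    at0 : ∀ σ s → reachᴺ s ≤ suc n → countTrue (prior r (σ , s , zero) ++ map μ (star (σ , s , zero))) ≡ 1
    at0 σ s = exact (σ , s , zero)

    1≤1+n : 1 ≤ suc n
    1≤1+n = s≤s z≤n

  halfState : ∀ σ → ∃ λ h → (∀ p → halfValue h p ≡ μ (0 , half σ p)) × middleValue h ≡ μ (0 , middle)
  halfState σ with solveHalf _ _ _ _ _ _ _ _ _
    (at0 σ (corner left) 1≤1+n) (at0 σ (corner right) 1≤1+n) (at0 σ top 1≤1+n)
    (at0 σ (base left) 1≤1+n) (at0 σ (base right) 1≤1+n) (at0 σ mid 1≤1+n)
  ... | h , eq = h , values , cong (λ t → proj₂ (proj₂ (proj₂ (proj₂ t)))) eq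
    where
    values : ∀ p → halfValue h p ≡ μ (0 , half σ p)
    values (side left)  = cong (λ t → proj₁ (proj₁ t)) eq
    values (side right) = cong (λ t → proj₂ (proj₁ t)) eq
    values (tip left)   = cong (λ t → proj₁ (proj₁ (proj₂ t))) eq
    values (tip right)  = cong (λ t → proj₂ (proj₁ (proj₂ t))) eq
    values (exit left)  = cong (λ t → proj₁ (proj₁ (proj₂ (proj₂ t)))) eq
    values (exit right) = cong (λ t → proj₂ (proj₁ (proj₂ (proj₂ t)))) eq
    values (arm left)   = cong (λ t → proj₁ (proj₁ (proj₂ (proj₂ (proj₂ t))))) eq
    values (arm right)  = cong (λ t → proj₂ (proj₁ (proj₂ (proj₂ (proj₂ t))))) eq

  private
    sameExit : ∀ r a a′ c → countTrue (r ∷ a ∷ c ∷ []) ≡ 1 → countTrue (r ∷ a′ ∷ c ∷ []) ≡ 1 → a ≡ a′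
    sameExit r     false false c     _ _ = refl
    sameExit r     true  true  c     _ _ = refl
    sameExit true  false true  c     _ ()
    sameExit true  true  false c     () _
    sameExit false false true  true  _ ()
    sameExit false false true  false () _
    sameExit false true  false true  () _
    sameExit false true  false false _ ()

    combine : ∀ h h′ → middleValue h ≡ middleValue h′ → halfValue h (exit left) ≡ halfValue h′ (exit left) →
              ∃ λ t → halfOf t up ≡ h × halfOf t low ≡ h′
    combine (ring δ)      (ring δ′)     _ _ = rings δ δ′ , refl , refl
    combine (exits left)  (exits left)  _ _ = exits left , refl , refl
    combine (exits right) (exits right) _ _ = exits right , refl , refl

  firstLetter : ∃ λ t → (∀ σ p → value t (half σ p) ≡ μ (0 , half σ p)) × value t middle ≡ μ (0 , middle)
  firstLetter with halfState up | halfState low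
  ... | h , vals , mid≡ | h′ , vals′ , mid′≡
    with combine h h′ (trans mid≡ (sym mid′≡))
      (trans (vals (exit left)) (trans
        (sameExit r _ _ _ (at0 up joint z≤n) (at0 low joint z≤n))
        (sym (vals′ (exit left)))))
  ... | t , refl , refl = t , (λ { up p → vals p ; low p → vals′ p }) , mid≡

solveJoint : ∀ r l c → countTrue (r ∷ l ∷ c ∷ []) ≡ 1 → r ∧ l ≡ false × not r ∧ not l ≡ c
solveJoint true  true  c     ()
solveJoint true  false true  ()
solveJoint true  false false _ = refl , refl
solveJoint false true  true  ()
solveJoint false true  false _ = refl , refl
solveJoint false false true  _ = refl , refl
solveJoint false false false ()

unsupported : ∀ {n μ} → Supported n μ → ∀ ε → ¬ Within n ε → false ≡ μ ε
unsupported {μ = μ} supp ε out with μ ε in eq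
... | false = refl
... | true  = contradiction (supp ε eq) out

reconstruct : ∀ r n {μ} → Exact r n μ → Supported n μ →
              ∃ λ w → Admissible r n w × (∀ ε → mem r w ε ≡ μ ε)
reconstruct r zero {μ} exact supp = [] , [] , agree
  where
  agree : ∀ ε → mem r [] ε ≡ μ ε
  agree (zero , cut) = proj₂ (solveJoint r false _
    (subst (λ b → countTrue (r ∷ b ∷ μ (0 , cut) ∷ []) ≡ 1)
      (sym (unsupported supp (0 , half up (exit left)) λ ())) (exact (up , joint , zero) z≤n)))
  agree (zero , half σ p) = unsupported supp (0 , half σ p) λ ()
  agree (zero , middle)   = unsupported supp (0 , middle) λ ()
  agree (suc i , l)       = unsupported supp (suc i , l) λ ()
reconstruct r (suc n) {μ} exact supp with firstLetter exact
... | t , halves , mid≡ with reconstruct (exitsTo right t) n {λ ε → μ (next ε)} exact′ (λ { (i , l) e → s≤s⁻¹ (supp (suc i , l) e) })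
  where
  exact′ : Exact (exitsTo right t) n (λ ε → μ (next ε))
  exact′ (σ , joint , zero)    p = subst (λ b → countTrue (b ∷ _ ∷ _ ∷ []) ≡ 1)
    (trans (sym (halves σ (exit right))) (exit-halfOf t σ right)) (exact (σ , joint , 1) (s≤s p))
  exact′ (σ , joint , suc i) p = exact (σ , joint , suc (suc i)) (s≤s p)
  exact′ (σ , mid , i)       p = exact (σ , mid , suc i) (s≤s p)
  exact′ (σ , top , i)       p = exact (σ , top , suc i) (s≤s p)
  exact′ (σ , base δ , i)    p = exact (σ , base δ , suc i) (s≤s p)
  exact′ (σ , corner δ , i)  p = exact (σ , corner δ , suc i) (s≤s p)
... | w , adm , agree = t ∷ w , proj₁ atJoint ∷ adm , agree′
  where
  atJoint : r ∧ exitsTo left t ≡ false × not r ∧ not (exitsTo left t) ≡ μ (0 , cut)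
  atJoint = solveJoint r (exitsTo left t) (μ (0 , cut))
    (subst (λ b → countTrue (r ∷ b ∷ μ (0 , cut) ∷ []) ≡ 1)
      (trans (sym (halves up (exit left))) (exit-halfOf t up left)) (exact (up , joint , 0) z≤n))
  agree′ : ∀ ε → mem r (t ∷ w) ε ≡ μ ε
  agree′ (zero  , cut)      = proj₂ atJoint
  agree′ (zero  , half σ p) = halves σ p
  agree′ (zero  , middle)   = mid≡
  agree′ (suc i , l)        = agree (i , l)

-- Forcing

weightᴸ : Letter → ℕ
weightᴸ (rings _ _) = 2
weightᴸ (exits _)   = 1

weight : Word → ℕ
weight []      = 0
weight (t ∷ w) = weightᴸ t + weight w

keyLocs : Letter → List Loc
keyLocs (rings δ δ′) = half up (arm δ) ∷ half low (arm δ′) ∷ []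
keyLocs (exits δ)    = half up (exit δ) ∷ []

keys : Word → List Label
keys []      = []
keys (t ∷ w) = map first (keyLocs t) ++ map next (keys w)

length-keys : ∀ w → length (keys w) ≡ weight w
length-keys []               = refl
length-keys (rings _ _ ∷ w) = cong (λ k → suc (suc k)) (trans (length-map next (keys w)) (length-keys w))
length-keys (exits _ ∷ w)   = cong suc (trans (length-map next (keys w)) (length-keys w))

==-refl : ∀ δ → (δ == δ) ≡ true
==-refl left  = refl
==-refl right = refl

==⇒≡ : ∀ δ δ′ → (δ == δ′) ≡ true → δ ≡ δ′
==⇒≡ left  left  _ = refl
==⇒≡ right right _ = refl

mem-keys : ∀ r w → All (λ ε → mem r w ε ≡ true) (keys w)
mem-keys r []      = []
mem-keys r (t ∷ w) = All.++⁺ (All.map⁺ (head t)) (All.map⁺ (mem-keys (exitsTo right t) w))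
  where
  head : ∀ t → All (λ l → mem r (t ∷ w) (0 , l) ≡ true) (keyLocs t)
  head (rings δ δ′) = ==-refl δ ∷ ==-refl δ′ ∷ []
  head (exits δ)    = ==-refl δ ∷ []

keyLocs-determine : ∀ t t′ → All (λ l → value t′ l ≡ true) (keyLocs t) → t′ ≡ t
keyLocs-determine (rings δ γ) (rings δ′ γ′) (p ∷ q ∷ []) = cong₂ rings (==⇒≡ δ′ δ p) (==⇒≡ γ′ γ q)
keyLocs-determine (rings δ γ) (exits δ′)    (() ∷ _)
keyLocs-determine (exits δ)   (rings δ′ γ′) (() ∷ _)
keyLocs-determine (exits δ)   (exits δ′)    (p ∷ []) = cong exits (==⇒≡ δ′ δ p)

keys-determine : ∀ {r r′ s n w w′} → Admissible r n w → Admissible r′ n w′ →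
                 All (λ ε → mem s w′ ε ≡ true) (keys w) → w′ ≡ w
keys-determine [] [] _ = refl
keys-determine {s = s} {w = t ∷ w} {w′ = t′ ∷ w′} (_ ∷ a) (_ ∷ a′) ps =
  cong₂ _∷_ (keyLocs-determine t t′ (head t (All.map⁻ (All.++⁻ˡ (map first (keyLocs t)) ps))))
            (keys-determine a a′ (All.map⁻ (All.++⁻ʳ (map first (keyLocs t)) ps)))
  where
  head : ∀ t → All (λ l → mem s (t′ ∷ w′) (0 , l) ≡ true) (keyLocs t) → All (λ l → value t′ l ≡ true) (keyLocs t)
  head (rings _ _) (p ∷ q ∷ []) = p ∷ q ∷ []
  head (exits _)   (p ∷ [])     = p ∷ []

admissible-weaken : ∀ {r n w} → Admissible r n w → Admissible false n w
admissible-weaken []      = []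
admissible-weaken (_ ∷ a) = refl ∷ a

-- Rotating one of the disjoint alternating hexagons of a letter yields a
-- letter in which rings replace whatever was there, which is admissible in
-- every context; a cut covered before is then still covered.
data _↝_ : Letter → Letter → Set where
  rotateUp  : ∀ {δ δ′} → rings δ δ′ ↝ rings (opposite δ) δ′
  rotateLow : ∀ {δ δ′} → rings δ δ′ ↝ rings δ (opposite δ′)
  rotateIn  : ∀ {δ}    → exits δ    ↝ rings δ δ

↝⇒rings : ∀ {t t′} → t ↝ t′ → ∃ λ δ → ∃ λ δ′ → t′ ≡ rings δ δ′
↝⇒rings rotateUp  = _ , _ , refl
↝⇒rings rotateLow = _ , _ , refl
↝⇒rings rotateIn  = _ , _ , refl

↝⇒≢ : ∀ {t t′} → t ↝ t′ → t′ ≢ t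
↝⇒≢ (rotateUp {left})         ()
↝⇒≢ (rotateUp {right})        ()
↝⇒≢ (rotateLow {_} {left})    ()
↝⇒≢ (rotateLow {_} {right})   ()
↝⇒≢ rotateIn                  ()

Lost : Letter → Letter → Loc → Set
Lost t t′ l = value t l ≡ true × value t′ l ≡ false

conflict : ∀ {b} → b ≡ true → b ≡ false → ∀ {A : Set} → A
conflict refl ()

mem-false : ∀ r w ε → mem r w ε ≡ true → mem false w ε ≡ true
mem-false false w       ε                 e = e
mem-false true  []      (zero  , cut)      ()
mem-false true  (t ∷ w) (zero  , cut)      ()
mem-false true  (t ∷ w) (zero  , half _ _) e = e
mem-false true  (t ∷ w) (zero  , middle)   e = e
mem-false true  (t ∷ w) (suc i , l)        e = e

Separated : (Label → Set) → Bool → ℕ → Word → Set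
Separated Q r n w = ∀ w′ → Admissible r n w′ → w′ ≢ w →
  ∃ λ ε → Q ε × mem r w ε ≡ true × mem r w′ ε ≡ false

separated-tail : ∀ {Q r n t w} → r ∧ exitsTo left t ≡ false → Separated Q r (suc n) (t ∷ w) →
                 Separated (λ ε → Q (next ε)) (exitsTo right t) n w
separated-tail {t = t} ok sep w′ a′ w′≢w with sep (t ∷ w′) (ok ∷ a′) (λ { refl → w′≢w refl })
... | (zero  , cut)      , _ , e , e′ = conflict e e′
... | (zero  , half _ _) , _ , e , e′ = conflict e e′
... | (zero  , middle)   , _ , e , e′ = conflict e e′
... | (suc i , l)        , q , e , e′ = (i , l) , q , e , e′

separated-head : ∀ {Q r n t t′ w} → Admissible r (suc n) (t ∷ w) → Separated Q r (suc n) (t ∷ w) →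
                 t ↝ t′ → ∃ λ l → Q (0 , l) × Lost t t′ l
separated-head {r = r} {t = t} {w = w} (ok ∷ a) sep t↝t′ with ↝⇒rings t↝t′
... | δ , δ′ , refl with sep (rings δ δ′ ∷ w) (∧-zeroʳ r ∷ admissible-weaken a) (λ { refl → ↝⇒≢ t↝t′ refl })
... | (zero  , half σ p) , q , e , e′ = half σ p , q , e , e′
... | (zero  , middle)   , q , e , e′ = middle , q , e , e′
... | (suc i , l)        , _ , e , e′ = conflict (mem-false (exitsTo right t) w (i , l) e) e′
... | (zero  , cut)      , _ , e , e′ = absurd r (exitsTo left t) e e′
  where
  absurd : ∀ r l → not r ∧ not l ≡ true → not r ∧ true ≡ false → ∀ {A : Set} → A
  absurd true  l () _
  absurd false l _ ()

lost-rotateUp : ∀ {δ δ′ l} → Lost (rings δ δ′) (rings (opposite δ) δ′) l → ∃ λ p → l ≡ half up p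
lost-rotateUp {l = half up p}  _        = p , refl
lost-rotateUp {l = half low p} (e , e′) = conflict e e′
lost-rotateUp {l = middle}     (() , _)
lost-rotateUp {l = cut}        (() , _)

lost-rotateLow : ∀ {δ δ′ l} → Lost (rings δ δ′) (rings δ (opposite δ′)) l → ∃ λ p → l ≡ half low p
lost-rotateLow {l = half up p}  (e , e′) = conflict e e′
lost-rotateLow {l = half low p} _        = p , refl
lost-rotateLow {l = middle}     (() , _)
lost-rotateLow {l = cut}        (() , _)

headHits : ∀ t {P : Loc → Set} → (∀ {t′} → t ↝ t′ → ∃ λ l → P l × Lost t t′ l) →
           ∃ λ ls → Unique ls × All P ls × length ls ≡ weightᴸ t
headHits (rings δ δ′) hit with hit rotateUp | hit rotateLow
... | l , pl , lost | l′ , pl′ , lost′ with lost-rotateUp {δ} {δ′} {l} lost | lost-rotateLow {δ} {δ′} {l′} lost′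
... | _ , refl | _ , refl = l ∷ l′ ∷ [] , ((λ ()) ∷ []) ∷ [] ∷ [] , pl ∷ pl′ ∷ [] , refl
headHits (exits δ) hit with hit rotateIn
... | l , pl , _ = l ∷ [] , [] ∷ [] , pl ∷ [] , refl

next-injective : ∀ {ε ε′} → next ε ≡ next ε′ → ε ≡ ε′
next-injective refl = refl

hits : ∀ {Q r n w} → Admissible r n w → Separated Q r n w →
       ∃ λ εs → Unique εs × All Q εs × length εs ≡ weight w
hits [] _ = [] , [] , [] , refl
hits {Q} {w = t ∷ w} (ok ∷ a) sep
  with headHits t {λ l → Q (0 , l)} (separated-head (ok ∷ a) sep) | hits a (separated-tail ok sep)
... | ls , ls! , ls-Q , ls-len | εs , εs! , εs-Q , εs-len =
    map first ls ++ map next εs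
  , Unique.++⁺ (Unique.map⁺ (λ { refl → refl }) ls!) (Unique.map⁺ next-injective εs!) disjoint
  , All.++⁺ (All.map⁺ ls-Q) (All.map⁺ εs-Q)
  , trans (length-++ (map first ls))
      (cong₂ _+_ (trans (length-map first ls) ls-len) (trans (length-map next εs) εs-len))
  where
  disjoint : Disjoint (map first ls) (map next εs)
  disjoint (p , q) with ∈-map⁻ first p | ∈-map⁻ next q
  ... | _ , _ , refl | _ , _ , ()

-- Enumeration of the admissible words

letters : Bool → List Letter
letters r = rings left left ∷ rings left right ∷ rings right left ∷ rings right right ∷ exits right ∷ leftExit r
  where
  leftExit : Bool → List Letter
  leftExit true  = []
  leftExit false = exits left ∷ []

words : Bool → ℕ → List Word
words r zero    = [ [] ]
words r (suc n) = concatMap (λ t → map (t ∷_) (words (exitsTo right t) n)) (letters r)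

letters⁺ : ∀ r t → r ∧ exitsTo left t ≡ false → t ∈ letters r
letters⁺ r     (rings left  left)  _ = ∈-lookup (# 0)
letters⁺ r     (rings left  right) _ = ∈-lookup (# 1)
letters⁺ r     (rings right left)  _ = ∈-lookup (# 2)
letters⁺ r     (rings right right) _ = ∈-lookup (# 3)
letters⁺ r     (exits right)       _ = ∈-lookup (# 4)
letters⁺ false (exits left)        _ = ∈-lookup (# 5)

letters⁻ : ∀ r → All (λ t → r ∧ exitsTo left t ≡ false) (letters r)
letters⁻ true  = refl ∷ refl ∷ refl ∷ refl ∷ refl ∷ []
letters⁻ false = refl ∷ refl ∷ refl ∷ refl ∷ refl ∷ refl ∷ []

letters-unique : ∀ r → Unique (letters r)
letters-unique true  =
  ((λ ()) ∷ (λ ()) ∷ (λ ()) ∷ (λ ()) ∷ []) ∷ ((λ ()) ∷ (λ ()) ∷ (λ ()) ∷ []) ∷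
  ((λ ()) ∷ (λ ()) ∷ []) ∷ ((λ ()) ∷ []) ∷ [] ∷ []
letters-unique false =
  ((λ ()) ∷ (λ ()) ∷ (λ ()) ∷ (λ ()) ∷ (λ ()) ∷ []) ∷ ((λ ()) ∷ (λ ()) ∷ (λ ()) ∷ (λ ()) ∷ []) ∷
  ((λ ()) ∷ (λ ()) ∷ (λ ()) ∷ []) ∷ ((λ ()) ∷ (λ ()) ∷ []) ∷ ((λ ()) ∷ []) ∷ [] ∷ []

words⁺ : ∀ {r n w} → Admissible r n w → w ∈ words r n
words⁺ []                      = here refl
words⁺ {r} {suc n} (_∷_ {t = t} ok a) =
  ∈-concatMap⁺ (λ t → map (t ∷_) (words (exitsTo right t) n)) (lose (letters⁺ r t ok) (∈-map⁺ (t ∷_) (words⁺ a)))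

words⁻ : ∀ r n {w} → w ∈ words r n → Admissible r n w
words⁻ r zero    (here refl) = []
words⁻ r (suc n) w∈ with find (∈-concatMap⁻ (λ t → map (t ∷_) (words (exitsTo right t) n)) {xs = letters r} w∈)
... | t , t∈ , w∈t with ∈-map⁻ (t ∷_) w∈t
...   | w , w∈′ , refl = All.lookup (letters⁻ r) t∈ ∷ words⁻ _ n w∈′

words-unique : ∀ r n → Unique (words r n)
words-unique r zero    = [] ∷ []
words-unique r (suc n) = Unique.concat⁺
  (All.map⁺ (All.universal (λ t → Unique.map⁺ ∷-injectiveʳ (words-unique (exitsTo right t) n)) (letters r)))
  (AllPairs.map⁺ (AllPairs.map disjoint (letters-unique r)))
  where
  disjoint : ∀ {t t′} → t ≢ t′ → Disjoint (map (t ∷_) (words (exitsTo right t) n)) (map (t′ ∷_) (words (exitsTo right t′) n))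
  disjoint {t} {t′} t≢t′ (p , q) with ∈-map⁻ (t ∷_) p | ∈-map⁻ (t′ ∷_) q
  ... | _ , _ , refl | _ , _ , eq = t≢t′ (∷-injectiveˡ eq)

-- Lists without repetitions

unique-↭ : ∀ {A : Set} {xs ys : List A} → Unique xs → Unique ys → xs ⊆ ys → ys ⊆ xs → xs ↭ ys
unique-↭ xs! ys! xs⊆ys ys⊆xs = ∼bag⇒↭ (unique∧set⇒bag xs! ys! (mk⇔ xs⊆ys ys⊆xs))

unique-⊆⇒length≤ : ∀ {A : Set} {xs ys : List A} → Unique xs → xs ⊆ ys → length xs ≤ length ys
unique-⊆⇒length≤ [] _ = z≤n
unique-⊆⇒length≤ {xs = x ∷ xs} (x∉xs ∷ xs!) sub with ∈-∃++ (sub (here refl))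
... | as , bs , refl = ≤-trans (s≤s (unique-⊆⇒length≤ xs! sub′))
  (≤-reflexive (trans (cong suc (length-++ as)) (trans (sym (+-suc (length as) (length bs))) (sym (length-++ as)))))
  where
  sub′ : xs ⊆ as ++ bs
  sub′ {z} z∈ with ∈-++⁻ as (sub (there z∈))
  ... | inj₁ p            = ∈-++⁺ˡ p
  ... | inj₂ (there p)    = ∈-++⁺ʳ as p
  ... | inj₂ (here refl)  = contradiction refl (All.lookup x∉xs z∈)

module _ {A : Set} where

  filter∈subsets : ∀ {P : A → Set} (P? : Decidable P) xs → filter P? xs ∈ subsets xs
  filter∈subsets P? []       = here refl
  filter∈subsets P? (x ∷ xs) with P? x
  ... | yes _ = ∈-++⁺ˡ (∈-map⁺ (x ∷_) (filter∈subsets P? xs))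
  ... | no  _ = ∈-++⁺ʳ (map (x ∷_) (subsets xs)) (filter∈subsets P? xs)

  subsets⇒⊆ : ∀ {xs M : List A} → M ∈ subsets xs → M ⊆ xs
  subsets⇒⊆ {[]}     (here refl) ()
  subsets⇒⊆ {x ∷ xs} M∈ with ∈-++⁻ (map (x ∷_) (subsets xs)) M∈
  ... | inj₂ M∈′ = there ∘ subsets⇒⊆ M∈′
  ... | inj₁ xM∈ with ∈-map⁻ (x ∷_) xM∈
  ...   | M′ , M′∈ , refl = λ { (here refl) → here refl ; (there p) → there (subsets⇒⊆ M′∈ p) }

  subsets⇒unique : ∀ {xs M : List A} → Unique xs → M ∈ subsets xs → Unique M
  subsets⇒unique {[]}     []          (here refl) = []
  subsets⇒unique {x ∷ xs} (x∉ ∷ xs!) M∈ with ∈-++⁻ (map (x ∷_) (subsets xs)) M∈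
  ... | inj₂ M∈′ = subsets⇒unique xs! M∈′
  ... | inj₁ xM∈ with ∈-map⁻ (x ∷_) xM∈
  ...   | M′ , M′∈ , refl = All.tabulate (λ p → All.lookup x∉ (subsets⇒⊆ M′∈ p)) ∷ subsets⇒unique xs! M′∈

  subsets-ext : ∀ {xs M M′ : List A} → Unique xs → M ∈ subsets xs → M′ ∈ subsets xs → M ⊆ M′ → M′ ⊆ M → M ≡ M′
  subsets-ext {[]} _ (here refl) (here refl) _ _ = refl
  subsets-ext {x ∷ xs} {M} {M′} (x∉ ∷ xs!) M∈ M′∈ M⊆M′ M′⊆M
    with ∈-++⁻ (map (x ∷_) (subsets xs)) M∈ | ∈-++⁻ (map (x ∷_) (subsets xs)) M′∈
  ... | inj₂ p | inj₂ q = subsets-ext xs! p q M⊆M′ M′⊆M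
  ... | inj₁ p | inj₂ q with ∈-map⁻ (x ∷_) p
  ...   | _ , _ , refl = contradiction refl (All.lookup x∉ (subsets⇒⊆ q (M⊆M′ (here refl))))
  subsets-ext {x ∷ xs} {M} {M′} (x∉ ∷ xs!) M∈ M′∈ M⊆M′ M′⊆M | inj₂ p | inj₁ q with ∈-map⁻ (x ∷_) q
  ...   | _ , _ , refl = contradiction refl (All.lookup x∉ (subsets⇒⊆ p (M′⊆M (here refl))))
  subsets-ext {x ∷ xs} {M} {M′} (x∉ ∷ xs!) M∈ M′∈ M⊆M′ M′⊆M | inj₁ p | inj₁ q
    with ∈-map⁻ (x ∷_) p | ∈-map⁻ (x ∷_) q
  ...   | N , N∈ , refl | N′ , N′∈ , refl =
    cong (x ∷_) (subsets-ext xs! N∈ N′∈ (strip N∈ M⊆M′) (strip N′∈ M′⊆M))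
    where
    strip : ∀ {L L′} → L ∈ subsets xs → x ∷ L ⊆ x ∷ L′ → L ⊆ L′
    strip L∈ sub z∈ with sub (there z∈)
    ... | there p   = p
    ... | here refl = contradiction refl (All.lookup x∉ (subsets⇒⊆ L∈ z∈))

  subsets-unique : ∀ {xs : List A} → Unique xs → Unique (subsets xs)
  subsets-unique []                     = [] ∷ []
  subsets-unique {x ∷ xs} (x∉ ∷ xs!) =
    Unique.++⁺ (Unique.map⁺ ∷-injectiveʳ (subsets-unique xs!)) (subsets-unique xs!) disjoint
    where
    disjoint : Disjoint (map (x ∷_) (subsets xs)) (subsets xs)
    disjoint (p , q) with ∈-map⁻ (x ∷_) p
    ... | _ , _ , refl = All.lookup x∉ (subsets⇒⊆ q (here refl)) refl

-- Vertices and edges of H n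

column : Site → ℕ
column joint          = 1
column mid            = 3
column top            = 3
column (base left)    = 2
column (base right)   = 4
column (corner left)  = 2
column (corner right) = 4

row : Side → Site → ℕ
row up  top        = 3
row up  (corner _) = 3
row up  _          = 2
row low top        = 0
row low (corner _) = 0
row low _          = 1

vertex : Node → Point
vertex (σ , s , i) = (column s + i * 4 , row σ s)

splitColumn : ℕ → ℕ × ℕ
splitColumn (suc (suc (suc (suc (suc x))))) = map₂ suc (splitColumn (suc x))
splitColumn x                               = x , 0

-- Junk off the columns 1, …, 4 and off the points of a fragment.
siteAt : ℕ → ℕ → Side × Site
siteAt 1 1 = low , joint
siteAt 1 2 = up  , joint
siteAt 2 0 = low , corner left
siteAt 2 1 = low , base left
siteAt 2 2 = up  , base left
siteAt 2 3 = up  , corner left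
siteAt 3 0 = low , top
siteAt 3 1 = low , mid
siteAt 3 2 = up  , mid
siteAt 3 3 = up  , top
siteAt 4 0 = low , corner right
siteAt 4 1 = low , base right
siteAt 4 2 = up  , base right
siteAt 4 3 = up  , corner right
siteAt _ _ = up  , joint

unvertex : Point → Node
unvertex (x , y) with splitColumn x
... | c , i with siteAt c y
... | σ , s = σ , s , i

splitColumn-column : ∀ s i → splitColumn (column s + i * 4) ≡ (column s , i)
splitColumn-column joint          zero    = refl
splitColumn-column joint          (suc i) = cong (map₂ suc) (splitColumn-column joint i)
splitColumn-column mid            zero    = refl
splitColumn-column mid            (suc i) = cong (map₂ suc) (splitColumn-column mid i)
splitColumn-column top            zero    = refl
splitColumn-column top            (suc i) = cong (map₂ suc) (splitColumn-column top i)
splitColumn-column (base left)    zero    = refl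
splitColumn-column (base left)    (suc i) = cong (map₂ suc) (splitColumn-column (base left) i)
splitColumn-column (base right)   zero    = refl
splitColumn-column (base right)   (suc i) = cong (map₂ suc) (splitColumn-column (base right) i)
splitColumn-column (corner left)  zero    = refl
splitColumn-column (corner left)  (suc i) = cong (map₂ suc) (splitColumn-column (corner left) i)
splitColumn-column (corner right) zero    = refl
splitColumn-column (corner right) (suc i) = cong (map₂ suc) (splitColumn-column (corner right) i)

siteAt-row : ∀ σ s → siteAt (column s) (row σ s) ≡ (σ , s)
siteAt-row up  joint          = refl
siteAt-row up  mid            = refl
siteAt-row up  top            = refl
siteAt-row up  (base left)    = refl
siteAt-row up  (base right)   = refl
siteAt-row up  (corner left)  = refl
siteAt-row up  (corner right) = refl
siteAt-row low joint          = refl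
siteAt-row low mid            = refl
siteAt-row low top            = refl
siteAt-row low (base left)    = refl
siteAt-row low (base right)   = refl
siteAt-row low (corner left)  = refl
siteAt-row low (corner right) = refl

unvertex-vertex : ∀ ν → unvertex (vertex ν) ≡ ν
unvertex-vertex (σ , s , i) rewrite splitColumn-column s i | siteAt-row σ s = refl

vertex-injective : ∀ {ν ν′} → vertex ν ≡ vertex ν′ → ν ≡ ν′
vertex-injective {ν} {ν′} eq =
  trans (sym (unvertex-vertex ν)) (trans (cong unvertex eq) (unvertex-vertex ν′))

endpoints : Label → Node × Node
endpoints (i , half σ   (exit left))  = (σ , joint , i)      , (σ , base left , i)
endpoints (i , half σ   (exit right)) = (σ , base right , i) , (σ , joint , suc i)
endpoints (i , half σ   (arm left))   = (σ , base left , i)  , (σ , mid , i)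
endpoints (i , half σ   (arm right))  = (σ , mid , i)        , (σ , base right , i)
endpoints (i , half σ   (tip left))   = (σ , corner left , i) , (σ , top , i)
endpoints (i , half σ   (tip right))  = (σ , top , i)        , (σ , corner right , i)
endpoints (i , half up  (side δ))     = (up , base δ , i)    , (up , corner δ , i)
endpoints (i , half low (side δ))     = (low , corner δ , i) , (low , base δ , i)
endpoints (i , middle)                = (low , mid , i)      , (up , mid , i)
endpoints (i , cut)                   = (low , joint , i)    , (up , joint , i)

edge : Label → Point × Point
edge ε = vertex (proj₁ (endpoints ε)) , vertex (proj₂ (endpoints ε))

-- Junk on pairs of non-adjacent nodes.
label : Node → Node → Label
label (σ , joint , i)       (_ , base left , _)    = i , half σ (exit left)
label (σ , base right , i)  (_ , joint , _)        = i , half σ (exit right)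
label (σ , base left , i)   (_ , mid , _)          = i , half σ (arm left)
label (σ , mid , i)         (_ , base right , _)   = i , half σ (arm right)
label (σ , corner left , i) (_ , top , _)          = i , half σ (tip left)
label (σ , top , i)         (_ , corner right , _) = i , half σ (tip right)
label (σ , base δ , i)      (_ , corner _ , _)     = i , half σ (side δ)
label (σ , corner δ , i)    (_ , base _ , _)       = i , half σ (side δ)
label (σ , mid , i)         (_ , mid , _)          = i , middle
label (σ , _ , i)           _                      = i , cut

label-endpoints : ∀ ε → label (proj₁ (endpoints ε)) (proj₂ (endpoints ε)) ≡ ε
label-endpoints (i , half σ   (exit left))  = refl
label-endpoints (i , half σ   (exit right)) = refl
label-endpoints (i , half σ   (arm left))   = refl
label-endpoints (i , half σ   (arm right))  = refl
label-endpoints (i , half σ   (tip left))   = refl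
label-endpoints (i , half σ   (tip right))  = refl
label-endpoints (i , half up  (side left))  = refl
label-endpoints (i , half up  (side right)) = refl
label-endpoints (i , half low (side left))  = refl
label-endpoints (i , half low (side right)) = refl
label-endpoints (i , middle)                = refl
label-endpoints (i , cut)                   = refl

unedge : Point × Point → Label
unedge (p , q) = label (unvertex p) (unvertex q)

unedge-edge : ∀ ε → unedge (edge ε) ≡ ε
unedge-edge ε = trans
  (cong₂ label (unvertex-vertex (proj₁ (endpoints ε))) (unvertex-vertex (proj₂ (endpoints ε))))
  (label-endpoints ε)

edge-injective : ∀ {ε ε′} → edge ε ≡ edge ε′ → ε ≡ ε′
edge-injective {ε} {ε′} eq = trans (sym (unedge-edge ε)) (trans (cong unedge eq) (unedge-edge ε′))

star-endpoints : ∀ ε → ε ∈ star (proj₁ (endpoints ε)) × ε ∈ star (proj₂ (endpoints ε))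
star-endpoints (zero  , half σ (exit left)) = here refl , here refl
star-endpoints (suc i , half σ (exit left)) = there (here refl) , here refl
star-endpoints (i , half σ   (exit right))  = here refl , here refl
star-endpoints (i , half σ   (arm left))    = there (here refl) , here refl
star-endpoints (i , half σ   (arm right))   = there (here refl) , there (here refl)
star-endpoints (i , half σ   (tip left))    = there (here refl) , here refl
star-endpoints (i , half σ   (tip right))   = there (here refl) , there (here refl)
star-endpoints (i , half up  (side δ))      = there (there (here refl)) , here refl
star-endpoints (i , half low (side δ))      = here refl , there (there (here refl))
star-endpoints (i , middle)                 = there (there (here refl)) , there (there (here refl))
star-endpoints (zero  , cut)                = there (here refl) , there (here refl)
star-endpoints (suc i , cut)                = there (there (here refl)) , there (there (here refl))

EndOf : Node → Label → Set
EndOf ν ε = ν ≡ proj₁ (endpoints ε) ⊎ ν ≡ proj₂ (endpoints ε)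

endOf-star : ∀ ν → All (EndOf ν) (star ν)
endOf-star (up  , joint , zero)      = inj₁ refl ∷ inj₂ refl ∷ []
endOf-star (low , joint , zero)      = inj₁ refl ∷ inj₁ refl ∷ []
endOf-star (up  , joint , suc i)     = inj₂ refl ∷ inj₁ refl ∷ inj₂ refl ∷ []
endOf-star (low , joint , suc i)     = inj₂ refl ∷ inj₁ refl ∷ inj₁ refl ∷ []
endOf-star (up  , mid , i)           = inj₂ refl ∷ inj₁ refl ∷ inj₂ refl ∷ []
endOf-star (low , mid , i)           = inj₂ refl ∷ inj₁ refl ∷ inj₁ refl ∷ []
endOf-star (σ   , top , i)           = inj₂ refl ∷ inj₁ refl ∷ []
endOf-star (up  , base left , i)     = inj₂ refl ∷ inj₁ refl ∷ inj₁ refl ∷ []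
endOf-star (low , base left , i)     = inj₂ refl ∷ inj₁ refl ∷ inj₂ refl ∷ []
endOf-star (up  , base right , i)    = inj₁ refl ∷ inj₂ refl ∷ inj₁ refl ∷ []
endOf-star (low , base right , i)    = inj₁ refl ∷ inj₂ refl ∷ inj₂ refl ∷ []
endOf-star (up  , corner left , i)   = inj₂ refl ∷ inj₁ refl ∷ []
endOf-star (low , corner left , i)   = inj₁ refl ∷ inj₁ refl ∷ []
endOf-star (up  , corner right , i)  = inj₂ refl ∷ inj₂ refl ∷ []
endOf-star (low , corner right , i)  = inj₁ refl ∷ inj₂ refl ∷ []

star-unique : ∀ ν → Unique (star ν)
star-unique (σ , joint , zero)  = ((λ ()) ∷ []) ∷ [] ∷ []
star-unique (σ , joint , suc i) = ((λ ()) ∷ (λ ()) ∷ []) ∷ ((λ ()) ∷ []) ∷ [] ∷ []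
star-unique (σ , mid , i)       = ((λ ()) ∷ (λ ()) ∷ []) ∷ ((λ ()) ∷ []) ∷ [] ∷ []
star-unique (σ , top , i)       = ((λ ()) ∷ []) ∷ [] ∷ []
star-unique (σ , base δ , i)    = ((λ ()) ∷ (λ ()) ∷ []) ∷ ((λ ()) ∷ []) ∷ [] ∷ []
star-unique (σ , corner δ , i)  = ((λ ()) ∷ []) ∷ [] ∷ []

hexagonsAt : ℕ → List Point
hexagonsAt k = (1 + k , 1) ∷ (3 + k , 1) ∷ (2 + k , 2) ∷ (2 + k , 0) ∷ []

pyreneFragment≡hexagonsAt : ∀ i → pyreneFragment i ≡ hexagonsAt (i * 4)
pyreneFragment≡hexagonsAt i = cong hexagonsAt (*-comm 4 i)

fragmentLabels : ℕ → List Label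
fragmentLabels i =
  (i , half low (exit left)) ∷ (i , half low (arm left)) ∷ (i , half up (exit left)) ∷ (i , half up (arm left)) ∷ (i , cut) ∷ (i , middle) ∷
  (i , half low (arm right)) ∷ (i , half low (exit right)) ∷ (i , half up (arm right)) ∷ (i , half up (exit right)) ∷ (i , middle) ∷ (suc i , cut) ∷
  (i , half up (arm left)) ∷ (i , half up (arm right)) ∷ (i , half up (tip left)) ∷ (i , half up (tip right)) ∷ (i , half up (side left)) ∷ (i , half up (side right)) ∷
  (i , half low (tip left)) ∷ (i , half low (tip right)) ∷ (i , half low (arm left)) ∷ (i , half low (arm right)) ∷ (i , half low (side left)) ∷ (i , half low (side right)) ∷ []

fragmentNodes : ℕ → List Node
fragmentNodes i =
  (low , joint , i) ∷ (low , base left , i) ∷ (low , mid , i) ∷ (up , joint , i) ∷ (up , base left , i) ∷ (up , mid , i) ∷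
  (low , mid , i) ∷ (low , base right , i) ∷ (low , joint , suc i) ∷ (up , mid , i) ∷ (up , base right , i) ∷ (up , joint , suc i) ∷
  (up , base left , i) ∷ (up , mid , i) ∷ (up , base right , i) ∷ (up , corner left , i) ∷ (up , top , i) ∷ (up , corner right , i) ∷
  (low , corner left , i) ∷ (low , top , i) ∷ (low , corner right , i) ∷ (low , base left , i) ∷ (low , mid , i) ∷ (low , base right , i) ∷ []

fragmentEdges≡ : ∀ i → concatMap hexagonEdges (pyreneFragment i) ≡ map edge (fragmentLabels i)
fragmentEdges≡ i = cong (concatMap hexagonEdges) (pyreneFragment≡hexagonsAt i)

fragmentVertices≡ : ∀ i → concatMap hexagonVertices (pyreneFragment i) ≡ map vertex (fragmentNodes i)
fragmentVertices≡ i = cong (concatMap hexagonVertices) (pyreneFragment≡hexagonsAt i)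

module _ {A : Set} (f : Point → List A) {n : ℕ} {x : A} where

  ∈-fragments⁺ : ∀ {i} → i < n → x ∈ concatMap f (pyreneFragment i) →
                 x ∈ concatMap f (concatMap pyreneFragment (upTo n))
  ∈-fragments⁺ {i} i<n x∈ with find (∈-concatMap⁻ f {xs = pyreneFragment i} x∈)
  ... | h , h∈ , x∈h = ∈-concatMap⁺ f (lose (∈-concatMap⁺ pyreneFragment (lose {P = λ j → h ∈ pyreneFragment j} (∈-upTo⁺ i<n) h∈)) x∈h)

  ∈-fragments⁻ : x ∈ concatMap f (concatMap pyreneFragment (upTo n)) →
                 ∃ λ i → i < n × x ∈ concatMap f (pyreneFragment i)
  ∈-fragments⁻ x∈ with find (∈-concatMap⁻ f {xs = concatMap pyreneFragment (upTo n)} x∈)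
  ... | h , h∈ , x∈h with find (∈-concatMap⁻ pyreneFragment {xs = upTo n} h∈)
  ...   | i , i∈ , h∈i = i , ∈-upTo⁻ i∈ , ∈-concatMap⁺ f (lose h∈i x∈h)

fragmentLabels-within : ∀ {i n} → i < n → All (Within n) (fragmentLabels i)
fragmentLabels-within {i} {n} i<n =
  p ∷ p ∷ p ∷ p ∷ q ∷ p ∷ p ∷ p ∷ p ∷ p ∷ p ∷ r ∷ p ∷ p ∷ p ∷ p ∷ p ∷ p ∷ p ∷ p ∷ p ∷ p ∷ p ∷ p ∷ []
  where
  p = subst (_≤ n) (+-comm 1 i) i<n
  r = subst (_≤ n) (+-comm 0 (suc i)) i<n
  q = ≤-trans (n≤1+n (i + 0)) r

fragmentNodes-within : ∀ {i n} → i < n → All (Withinᴺ n) (fragmentNodes i)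
fragmentNodes-within {i} {n} i<n =
  q ∷ p ∷ p ∷ q ∷ p ∷ p ∷ p ∷ p ∷ r ∷ p ∷ p ∷ r ∷ p ∷ p ∷ p ∷ p ∷ p ∷ p ∷ p ∷ p ∷ p ∷ p ∷ p ∷ p ∷ []
  where
  p = subst (_≤ n) (+-comm 1 i) i<n
  r = subst (_≤ n) (+-comm 0 (suc i)) i<n
  q = ≤-trans (n≤1+n (i + 0)) r

within⇒fragmentLabels : ∀ {n} → 1 ≤ n → ∀ ε → Within n ε → ∃ λ i → i < n × ε ∈ fragmentLabels i
within⇒fragmentLabels {n} 1≤n (i , l) p = go i l p
  where
  lt : ∀ {i} → i + 1 ≤ n → i < n
  lt {i} = subst (_≤ n) (+-comm i 1)
  go : ∀ i l → Within n (i , l) → ∃ λ j → j < n × (i , l) ∈ fragmentLabels j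
  go i (half up  (exit left))  p = i , lt p , ∈-lookup (# 2)
  go i (half up  (exit right)) p = i , lt p , ∈-lookup (# 9)
  go i (half up  (arm left))   p = i , lt p , ∈-lookup (# 3)
  go i (half up  (arm right))  p = i , lt p , ∈-lookup (# 8)
  go i (half up  (side left))  p = i , lt p , ∈-lookup (# 16)
  go i (half up  (side right)) p = i , lt p , ∈-lookup (# 17)
  go i (half up  (tip left))   p = i , lt p , ∈-lookup (# 14)
  go i (half up  (tip right))  p = i , lt p , ∈-lookup (# 15)
  go i (half low (exit left))  p = i , lt p , ∈-lookup (# 0)
  go i (half low (exit right)) p = i , lt p , ∈-lookup (# 7)
  go i (half low (arm left))   p = i , lt p , ∈-lookup (# 1)
  go i (half low (arm right))  p = i , lt p , ∈-lookup (# 6)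
  go i (half low (side left))  p = i , lt p , ∈-lookup (# 22)
  go i (half low (side right)) p = i , lt p , ∈-lookup (# 23)
  go i (half low (tip left))   p = i , lt p , ∈-lookup (# 18)
  go i (half low (tip right))  p = i , lt p , ∈-lookup (# 19)
  go i middle                  p = i , lt p , ∈-lookup (# 5)
  go zero    cut               p = 0 , 1≤n , ∈-lookup (# 4)
  go (suc i) cut               p = i , subst (_≤ n) (+-comm (suc i) 0) p , ∈-lookup (# 11)

within⇒fragmentNodes : ∀ {n} → 1 ≤ n → ∀ ν → Withinᴺ n ν → ∃ λ i → i < n × ν ∈ fragmentNodes i
within⇒fragmentNodes {n} 1≤n (σ , s , i) p = go σ s i p
  where
  lt : ∀ {i} → i + 1 ≤ n → i < n
  lt {i} = subst (_≤ n) (+-comm i 1)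
  go : ∀ σ s i → Withinᴺ n (σ , s , i) → ∃ λ j → j < n × (σ , s , i) ∈ fragmentNodes j
  go up  mid            i p = i , lt p , ∈-lookup (# 5)
  go up  top            i p = i , lt p , ∈-lookup (# 16)
  go up  (base left)    i p = i , lt p , ∈-lookup (# 4)
  go up  (base right)   i p = i , lt p , ∈-lookup (# 10)
  go up  (corner left)  i p = i , lt p , ∈-lookup (# 15)
  go up  (corner right) i p = i , lt p , ∈-lookup (# 17)
  go low mid            i p = i , lt p , ∈-lookup (# 2)
  go low top            i p = i , lt p , ∈-lookup (# 19)
  go low (base left)    i p = i , lt p , ∈-lookup (# 1)
  go low (base right)   i p = i , lt p , ∈-lookup (# 7)
  go low (corner left)  i p = i , lt p , ∈-lookup (# 18)
  go low (corner right) i p = i , lt p , ∈-lookup (# 20)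
  go up  joint zero       p = 0 , 1≤n , ∈-lookup (# 3)
  go low joint zero       p = 0 , 1≤n , ∈-lookup (# 0)
  go up  joint (suc i)    p = i , subst (_≤ n) (+-comm (suc i) 0) p , ∈-lookup (# 11)
  go low joint (suc i)    p = i , subst (_≤ n) (+-comm (suc i) 0) p , ∈-lookup (# 8)

-- Perfect matchings of H n

countTrue-map : ∀ {A : Set} (μ : A → Bool) xs → countTrue (map μ xs) ≡ length (filter (λ x → μ x ≟ᵇ true) xs)
countTrue-map μ []       = refl
countTrue-map μ (x ∷ xs) with μ x
... | true  = cong suc (countTrue-map μ xs)
... | false = countTrue-map μ xs

countTrue-prior : ∀ ν {bs} → countTrue (prior false ν ++ bs) ≡ countTrue bs
countTrue-prior (_ , joint , zero)    = refl
countTrue-prior (_ , joint , suc _)   = refl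
countTrue-prior (_ , mid , _)         = refl
countTrue-prior (_ , top , _)         = refl
countTrue-prior (_ , base _ , _)      = refl
countTrue-prior (_ , corner _ , _)    = refl

record Pyrene (n : ℕ) (G : Graph Point) : Set where
  open Graph G
  field
    edges⁻    : ∀ {e} → e ∈ edges → ∃ λ ε → Within n ε × e ≡ edge ε
    edges⁺    : ∀ {ε} → Within n ε → edge ε ∈ edges
    vertices⁻ : ∀ {v} → v ∈ vertices → ∃ λ ν → Withinᴺ n ν × v ≡ vertex ν
    vertices⁺ : ∀ {ν} → Withinᴺ n ν → vertex ν ∈ vertices

H-pyrene : ∀ {n} → 1 ≤ n → Pyrene n (H n)
H-pyrene {n} 1≤n = record
  { edges⁻    = λ e∈ → edge⁻ (∈-fragments⁻ hexagonEdges {n} (∈-deduplicate⁻ _ (concatMap hexagonEdges (concatMap pyreneFragment (upTo n))) e∈))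
  ; edges⁺    = λ {ε} ε<n → edge⁺ (within⇒fragmentLabels 1≤n ε ε<n)
  ; vertices⁻ = λ v∈ → vertex⁻ (∈-fragments⁻ hexagonVertices {n} (∈-deduplicate⁻ _ (concatMap hexagonVertices (concatMap pyreneFragment (upTo n))) v∈))
  ; vertices⁺ = λ {ν} ν<n → vertex⁺ (within⇒fragmentNodes 1≤n ν ν<n)
  }
  where
  open Graph (H n)

  edge⁻ : ∀ {e} → (∃ λ i → i < n × e ∈ concatMap hexagonEdges (pyreneFragment i)) → ∃ λ ε → Within n ε × e ≡ edge ε
  edge⁻ {e} (i , i<n , e∈i) with ∈-map⁻ edge (subst (e ∈_) (fragmentEdges≡ i) e∈i)
  ... | ε , ε∈ , eq = ε , All.lookup (fragmentLabels-within i<n) ε∈ , eq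

  edge⁺ : ∀ {ε} → (∃ λ i → i < n × ε ∈ fragmentLabels i) → edge ε ∈ edges
  edge⁺ {ε} (i , i<n , ε∈) = ∈-deduplicate⁺ _
    (∈-fragments⁺ hexagonEdges i<n (subst (edge ε ∈_) (sym (fragmentEdges≡ i)) (∈-map⁺ edge ε∈)))

  vertex⁻ : ∀ {v} → (∃ λ i → i < n × v ∈ concatMap hexagonVertices (pyreneFragment i)) → ∃ λ ν → Withinᴺ n ν × v ≡ vertex ν
  vertex⁻ {v} (i , i<n , v∈i) with ∈-map⁻ vertex (subst (v ∈_) (fragmentVertices≡ i) v∈i)
  ... | ν , ν∈ , eq = ν , All.lookup (fragmentNodes-within i<n) ν∈ , eq

  vertex⁺ : ∀ {ν} → (∃ λ i → i < n × ν ∈ fragmentNodes i) → vertex ν ∈ vertices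
  vertex⁺ {ν} (i , i<n , ν∈) = ∈-deduplicate⁺ _
    (∈-fragments⁺ hexagonVertices i<n (subst (vertex ν ∈_) (sym (fragmentVertices≡ i)) (∈-map⁺ vertex ν∈)))

module PerfectMatchings {n : ℕ} {G : Graph Point} (pyrene : Pyrene n G) where

  open Graph G
  open Forcing _≟ᴾ_ G
  open Pyrene pyrene
  open import Data.List.Membership.DecPropositional _≟ᴱ_ using (_∈?_)

  incident⇒star : ∀ {ν ε} → Incident (vertex ν) (edge ε) → ε ∈ star ν
  incident⇒star {ν} {ε} (inj₁ eq) = subst (λ κ → ε ∈ star κ) (sym (vertex-injective eq)) (proj₁ (star-endpoints ε))
  incident⇒star {ν} {ε} (inj₂ eq) = subst (λ κ → ε ∈ star κ) (sym (vertex-injective eq)) (proj₂ (star-endpoints ε))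

  star⇒incident : ∀ {ν ε} → ε ∈ star ν → Incident (vertex ν) (edge ε)
  star⇒incident {ν} ε∈ with All.lookup (endOf-star ν) ε∈
  ... | inj₁ eq = inj₁ (cong vertex eq)
  ... | inj₂ eq = inj₂ (cong vertex eq)

  Represents : (Label → Bool) → List Edge → Set
  Represents μ M = ∀ ε → (μ ε ≡ true → edge ε ∈ M) × (edge ε ∈ M → μ ε ≡ true)

  degree : ∀ {M μ} → M ∈ subsets edges → Represents μ M → ∀ ν →
           length (filter (incident? (vertex ν)) M) ≡ countTrue (map μ (star ν))
  degree {M} {μ} M∈ rep ν = trans
    (↭-length (unique-↭
      (Unique.filter⁺ (incident? (vertex ν)) (subsets⇒unique edges! M∈))
      (Unique.map⁺ edge-injective (Unique.filter⁺ μ? (star-unique ν)))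
      to from))
    (trans (length-map edge (filter μ? (star ν))) (sym (countTrue-map μ (star ν))))
    where
    μ? : Decidable (λ ε → μ ε ≡ true)
    μ? ε = μ ε ≟ᵇ true
    to : filter (incident? (vertex ν)) M ⊆ map edge (filter μ? (star ν))
    to {e} e∈ with ∈-filter⁻ (incident? (vertex ν)) {xs = M} e∈
    ... | e∈M , inc with edges⁻ (subsets⇒⊆ M∈ e∈M)
    ...   | ε , _ , refl = ∈-map⁺ edge (∈-filter⁺ μ? (incident⇒star {ν} {ε} inc) (proj₂ (rep ε) e∈M))
    from : map edge (filter μ? (star ν)) ⊆ filter (incident? (vertex ν)) M
    from e∈ with ∈-map⁻ edge e∈
    ... | ε , ε∈ , refl with ∈-filter⁻ μ? {xs = star ν} ε∈
    ...   | ε∈star , με = ∈-filter⁺ (incident? (vertex ν)) (proj₁ (rep ε) με) (star⇒incident {ν} ε∈star)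

  exact⇒perfect : ∀ {M μ} → M ∈ subsets edges → Represents μ M → Exact false n μ → IsPerfect M
  exact⇒perfect {M} M∈ rep exact = All.tabulate λ v∈ → helper (vertices⁻ v∈)
    where
    helper : ∀ {v} → (∃ λ ν → Withinᴺ n ν × v ≡ vertex ν) → length (filter (incident? v) M) ≡ 1
    helper (ν , ν<n , refl) = trans (degree M∈ rep ν) (trans (sym (countTrue-prior ν)) (exact ν ν<n))

  perfect⇒exact : ∀ {M μ} → M ∈ subsets edges → Represents μ M → IsPerfect M → Exact false n μ
  perfect⇒exact M∈ rep perf ν ν<n =
    trans (countTrue-prior ν) (trans (sym (degree M∈ rep ν)) (All.lookup perf (vertices⁺ {ν} ν<n)))

  selected? : ∀ w → Decidable (λ e → mem false w (unedge e) ≡ true)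
  selected? w e = mem false w (unedge e) ≟ᵇ true

  encode : Word → List Edge
  encode w = filter (selected? w) edges

  encode∈subsets : ∀ w → encode w ∈ subsets edges
  encode∈subsets w = filter∈subsets (selected? w) edges

  encode-represents : ∀ {w} → Admissible false n w → Represents (mem false w) (encode w)
  encode-represents {w} a ε =
      (λ e → ∈-filter⁺ (selected? w) (edges⁺ {ε} (mem-supported a ε e)) (subst (λ κ → mem false w κ ≡ true) (sym (unedge-edge ε)) e))
    , (λ e∈ → subst (λ κ → mem false w κ ≡ true) (unedge-edge ε) (proj₂ (∈-filter⁻ (selected? w) {xs = edges} e∈)))

  encode-perfect : ∀ {w} → Admissible false n w → encode w ∈ perfectMatchings
  encode-perfect {w} a = ∈-filter⁺ isPerfect? (encode∈subsets w)
    (exact⇒perfect (encode∈subsets w) (encode-represents a) (mem-exact a))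

  member : List Edge → Label → Bool
  member M ε = does (edge ε ∈? M)

  member-represents : ∀ M → Represents (member M) M
  member-represents M ε with edge ε ∈? M
  ... | yes p = (λ _ → p) , (λ _ → refl)
  ... | no ¬p = (λ ()) , (λ p → contradiction p ¬p)

  perfect⇒encode : ∀ {M} → M ∈ perfectMatchings → ∃ λ w → Admissible false n w × M ≡ encode w
  perfect⇒encode {M} M∈pm with ∈-filter⁻ isPerfect? {xs = subsets edges} M∈pm
  ... | M∈ , perf with reconstruct false n (perfect⇒exact {μ = member M} M∈ (member-represents M) perf) supp
    where
    supp : Supported n (member M)
    supp ε e with edges⁻ (subsets⇒⊆ M∈ (proj₁ (member-represents M ε) e))
    ... | ε′ , ε′<n , eq = subst (Within n) (sym (edge-injective {ε} {ε′} eq)) ε′<n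
  ... | w , a , agree = w , a , subsets-ext edges! M∈ (encode∈subsets w) to from
    where
    to : M ⊆ encode w
    to e∈ with edges⁻ (subsets⇒⊆ M∈ e∈)
    ... | ε , _ , refl = proj₁ (encode-represents a ε) (trans (agree ε) (proj₂ (member-represents M ε) e∈))
    from : encode w ⊆ M
    from e∈ with edges⁻ (subsets⇒⊆ (encode∈subsets w) e∈)
    ... | ε , _ , refl = proj₁ (member-represents M ε) (trans (sym (agree ε)) (proj₂ (encode-represents a ε) e∈))

  keys⊆encode⇒≡ : ∀ {w w′} → Admissible false n w → Admissible false n w′ →
                  All (λ ε → edge ε ∈ encode w′) (keys w) → w′ ≡ w
  keys⊆encode⇒≡ a a′ ks = keys-determine {s = false} a a′ (All.map (λ {ε} → proj₂ (encode-represents a′ ε)) ks)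

  keys⊆encode : ∀ {w} → Admissible false n w → All (λ ε → edge ε ∈ encode w) (keys w)
  keys⊆encode {w} a = All.map (λ {ε} → proj₁ (encode-represents a ε)) (mem-keys false w)

  encode-injective : ∀ {w w′} → Admissible false n w → Admissible false n w′ → encode w ≡ encode w′ → w ≡ w′
  encode-injective {w} {w′} a a′ eq =
    sym (keys⊆encode⇒≡ a a′ (subst (λ M → All (λ ε → edge ε ∈ M) (keys w)) eq (keys⊆encode a)))

  map-encode-unique : ∀ {ws} → All (Admissible false n) ws → Unique ws → Unique (map encode ws)
  map-encode-unique []        []          = []
  map-encode-unique (a ∷ as) (w∉ ∷ ws!) =
    All.map⁺ (All.zipWith (λ (a′ , w≢) eq → w≢ (encode-injective a a′ eq)) (as , w∉)) ∷ map-encode-unique as ws!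

  words-admissible : All (Admissible false n) (words false n)
  words-admissible = All.tabulate (words⁻ false n)

  perfectMatchings↭ : perfectMatchings ↭ map encode (words false n)
  perfectMatchings↭ = unique-↭
    (Unique.filter⁺ isPerfect? (subsets-unique edges!))
    (map-encode-unique words-admissible (words-unique false n))
    to from
    where
    to : perfectMatchings ⊆ map encode (words false n)
    to M∈ with perfect⇒encode M∈
    ... | w , a , refl = ∈-map⁺ encode (words⁺ a)
    from : map encode (words false n) ⊆ perfectMatchings
    from M∈ with ∈-map⁻ encode M∈
    ... | w , w∈ , refl = encode-perfect (words⁻ false n w∈)

  keys-forcing : ∀ {w S} → Admissible false n w → All (λ ε → edge ε ∈ S) (keys w) → IsForcing (encode w) S
  keys-forcing {w} {S} a ks = All.tabulate λ M∈ S⊆M → helper (perfect⇒encode M∈) S⊆M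
    where
    helper : ∀ {M} → (∃ λ w′ → Admissible false n w′ × M ≡ encode w′) → S ⊆ M → M ≡ encode w
    helper (w′ , a′ , refl) S⊆M = cong encode (keys⊆encode⇒≡ a a′ (All.map S⊆M ks))

  forcing⇒weight≤ : ∀ {w S} → Admissible false n w → S ⊆ encode w → IsForcing (encode w) S → weight w ≤ length S
  forcing⇒weight≤ {w} {S} a S⊆M forcing with hits a separated
    where
    separated : Separated (λ ε → edge ε ∈ S) false n w
    separated w′ a′ w′≢w with find (All.¬All⇒Any¬ (_∈? encode w′) S λ S⊆M′ →
      w′≢w (encode-injective a′ a (All.lookup forcing (encode-perfect a′) (All.lookup S⊆M′))))
    ... | e , e∈S , e∉M′ with edges⁻ (subsets⇒⊆ (encode∈subsets w) (S⊆M e∈S))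
    ...   | ε , _ , refl = ε , e∈S , proj₂ (encode-represents a ε) (S⊆M e∈S) , ¬-not (e∉M′ ∘ proj₁ (encode-represents a′ ε))
  ... | εs , εs! , εs∈S , len = subst (_≤ length S) (trans (length-map edge εs) len)
    (unique-⊆⇒length≤ {xs = map edge εs} {S} (Unique.map⁺ edge-injective εs!) (All.lookup {P = _∈ S} (All.map⁺ {f = edge} εs∈S)))

  forcingNumber-encode : ∀ {w} → Admissible false n w → forcingNumber (encode w) ≡ weight w
  forcingNumber-encode {w} a = ≤-antisym
    (min≤v⁺ (length M) (map length (forcingSets M)) (inj₂ (lose
      (∈-map⁺ length (∈-filter⁺ (isForcing? M) (filter∈subsets key? M)
        (keys-forcing a (All.tabulate λ k∈ → ∈-filter⁺ key? (All.lookup (keys⊆encode a) k∈) (∈-map⁺ edge k∈)))))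
      length≤)))
    (v≤min⁺ (forcing⇒weight≤ a (λ e∈ → e∈) (keys-forcing a (keys⊆encode a)))
      (All.map⁺ {f = length} (All.tabulate λ {S} S∈ → helper {S} (∈-filter⁻ (isForcing? M) {xs = subsets M} S∈))))
    where
    M = encode w
    key? : Decidable (_∈ map edge (keys w))
    key? = _∈? map edge (keys w)
    length≤ : length (filter key? M) ≤ weight w
    length≤ = subst (length (filter key? M) ≤_) (trans (length-map edge (keys w)) (length-keys w))
      (unique-⊆⇒length≤ (Unique.filter⁺ key? (Unique.filter⁺ (selected? w) edges!))
        (λ e∈ → proj₂ (∈-filter⁻ key? {xs = M} e∈)))
    helper : ∀ {S} → S ∈ subsets M × IsForcing M S → weight w ≤ length S
    helper (S∈ , forcing) = forcing⇒weight≤ a (subsets⇒⊆ S∈) forcing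

-- The recursion

coeff-⊕ : ∀ p q k → coeff (p ⊕ q) k ≡ coeff p k ℤ.+ coeff q k
coeff-⊕ []      q       k       = sym (ℤ.+-identityˡ _)
coeff-⊕ (a ∷ p) []      k       = sym (ℤ.+-identityʳ _)
coeff-⊕ (a ∷ p) (b ∷ q) zero    = refl
coeff-⊕ (a ∷ p) (b ∷ q) (suc k) = coeff-⊕ p q k

coeff-map : ∀ (f : ℤ → ℤ) → f 0ℤ ≡ 0ℤ → ∀ p k → coeff (map f p) k ≡ f (coeff p k)
coeff-map f f0 []      k       = sym f0
coeff-map f f0 (a ∷ p) zero    = refl
coeff-map f f0 (a ∷ p) (suc k) = coeff-map f f0 p k

coeff-⊖ : ∀ p q k → coeff (p ⊖ q) k ≡ coeff p k ℤ.- coeff q k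
coeff-⊖ p q k = trans (coeff-⊕ p (map ℤ.-_ q) k) (cong (ℤ._+_ (coeff p k)) (coeff-map ℤ.-_ refl q k))

coeff-∷⊗ : ∀ a p q k → coeff ((a ∷ p) ⊗ q) k ≡ a ℤ.* coeff q k ℤ.+ coeff (0ℤ ∷ (p ⊗ q)) k
coeff-∷⊗ a p q k = trans (coeff-⊕ (a · q) (0ℤ ∷ (p ⊗ q)) k)
  (cong (ℤ._+ coeff (0ℤ ∷ (p ⊗ q)) k) (coeff-map (a ℤ.*_) (ℤ.*-zeroʳ a) q k))

sumPoly : List Poly → Poly
sumPoly = foldr _⊕_ []

sumPoly-↭ : ∀ {ps qs} → ps ↭ qs → sumPoly ps ≈ sumPoly qs
sumPoly-↭ Perm.refl k = refl
sumPoly-↭ (Perm.prep {ps} {qs} p ps↭qs) k =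
  trans (coeff-⊕ p (sumPoly ps) k) (trans (cong (ℤ._+_ (coeff p k)) (sumPoly-↭ ps↭qs k)) (sym (coeff-⊕ p (sumPoly qs) k)))
sumPoly-↭ (Perm.swap {ps} {qs} p q ps↭qs) k
  rewrite coeff-⊕ p (q ⊕ sumPoly ps) k | coeff-⊕ q (sumPoly ps) k
        | coeff-⊕ q (p ⊕ sumPoly qs) k | coeff-⊕ p (sumPoly qs) k
        | sumPoly-↭ ps↭qs k = exchange (coeff p k) (coeff q k) (coeff (sumPoly qs) k)
  where
  exchange : ∀ a b c → a ℤ.+ (b ℤ.+ c) ≡ b ℤ.+ (a ℤ.+ c)
  exchange = solve-∀
sumPoly-↭ (Perm.trans ps↭qs qs↭rs) k = trans (sumPoly-↭ ps↭qs k) (sumPoly-↭ qs↭rs k)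

wordPoly : List Word → Poly
wordPoly ws = sumPoly (map (λ w → x^ (weight w)) ws)

pyrene⇒F≈wordPoly : ∀ {n G} → Pyrene n G → F G ≈ wordPoly (words false n)
pyrene⇒F≈wordPoly {n} {G} pyrene k = trans
  (sumPoly-↭ (↭-map⁺ (λ M → x^ (forcingNumber M)) perfectMatchings↭) k)
  (cong (λ ps → coeff (sumPoly ps) k) (trans (sym (map-∘ (words false n)))
    (map-cong-local (All.map (λ a → cong x^_ (forcingNumber-encode a)) words-admissible))))
  where
  open PerfectMatchings pyrene
  open Forcing _≟ᴾ_ G using (forcingNumber)

F≈wordPoly : ∀ n → F (H n) ≈ wordPoly (words false n)
F≈wordPoly zero    = λ k → refl
F≈wordPoly (suc n) = positive (suc n) (s≤s z≤n)
  where
  positive : ∀ n → 1 ≤ n → F (H n) ≈ wordPoly (words false n)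
  positive n 1≤n = pyrene⇒F≈wordPoly {n} {H n} (H-pyrene 1≤n)

wordPoly-++ : ∀ vs ws k → coeff (wordPoly (vs ++ ws)) k ≡ coeff (wordPoly vs) k ℤ.+ coeff (wordPoly ws) k
wordPoly-++ []       ws k = sym (ℤ.+-identityˡ _)
wordPoly-++ (v ∷ vs) ws k
  rewrite coeff-⊕ (x^ (weight v)) (wordPoly (vs ++ ws)) k | coeff-⊕ (x^ (weight v)) (wordPoly vs) k | wordPoly-++ vs ws k =
  sym (ℤ.+-assoc (coeff (x^ (weight v)) k) _ _)

shift : ℕ → Poly → Poly
shift m p = replicate m 0ℤ ++ p

shift-⊕ : ∀ m p q k → coeff (shift m (p ⊕ q)) k ≡ coeff (shift m p) k ℤ.+ coeff (shift m q) k
shift-⊕ zero    p q k       = coeff-⊕ p q k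
shift-⊕ (suc m) p q zero    = refl
shift-⊕ (suc m) p q (suc k) = shift-⊕ m p q k

shift-[] : ∀ m k → coeff (shift m []) k ≡ 0ℤ
shift-[] zero    k       = refl
shift-[] (suc m) zero    = refl
shift-[] (suc m) (suc k) = shift-[] m k

x^-+ : ∀ a b → x^ (a + b) ≡ shift a (x^ b)
x^-+ zero    b = refl
x^-+ (suc a) b = cong (0ℤ ∷_) (x^-+ a b)

wordPoly-∷ : ∀ t ws k → coeff (wordPoly (map (t ∷_) ws)) k ≡ coeff (shift (weightᴸ t) (wordPoly ws)) k
wordPoly-∷ t []       k = sym (shift-[] (weightᴸ t) k)
wordPoly-∷ t (w ∷ ws) k
  rewrite coeff-⊕ (x^ (weightᴸ t + weight w)) (wordPoly (map (t ∷_) ws)) k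
        | shift-⊕ (weightᴸ t) (x^ (weight w)) (wordPoly ws) k
        | x^-+ (weightᴸ t) (weight w) | wordPoly-∷ t ws k = refl

wordPoly-concatMap : ∀ (f : Letter → List Word) ts k →
  coeff (wordPoly (concatMap (λ t → map (t ∷_) (f t)) ts)) k ≡
  foldr (λ t → ℤ._+_ (coeff (shift (weightᴸ t) (wordPoly (f t))) k)) 0ℤ ts
wordPoly-concatMap f []       k = refl
wordPoly-concatMap f (t ∷ ts) k = trans
  (wordPoly-++ (map (t ∷_) (f t)) (concatMap (λ t → map (t ∷_) (f t)) ts) k)
  (cong₂ ℤ._+_ (wordPoly-∷ t (f t) k) (wordPoly-concatMap f ts k))

wordPoly-step : ∀ r n k → coeff (wordPoly (words r (suc n))) k ≡
  foldr (λ t → ℤ._+_ (coeff (shift (weightᴸ t) (wordPoly (words (exitsTo right t) n))) k)) 0ℤ (letters r)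
wordPoly-step r n = wordPoly-concatMap (λ t → words (exitsTo right t) n) (letters r)

freePoly afterRightPoly : ℕ → Poly
freePoly n       = wordPoly (words false n)
afterRightPoly n = wordPoly (words true n)

-- The difference comes from the words that start with exits left.
freePoly-afterRightPoly : ∀ n k → coeff (freePoly (suc n)) k ≡ coeff (afterRightPoly (suc n)) k ℤ.+ coeff (shift 1 (freePoly n)) k
freePoly-afterRightPoly n k rewrite wordPoly-step false n k | wordPoly-step true n k =
  regroup (coeff (shift 2 (freePoly n)) k) (coeff (shift 1 (afterRightPoly n)) k) (coeff (shift 1 (freePoly n)) k)
  where
  regroup : ∀ a b c → a ℤ.+ (a ℤ.+ (a ℤ.+ (a ℤ.+ (b ℤ.+ (c ℤ.+ 0ℤ))))) ≡ a ℤ.+ (a ℤ.+ (a ℤ.+ (a ℤ.+ (b ℤ.+ 0ℤ)))) ℤ.+ c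
  regroup = solve-∀

freePoly-step : ∀ n k → coeff (freePoly (suc n)) k ≡
         + 4 ℤ.* coeff (shift 2 (freePoly n)) k ℤ.+ coeff (shift 1 (afterRightPoly n)) k ℤ.+ coeff (shift 1 (freePoly n)) k
freePoly-step n k rewrite wordPoly-step false n k =
  regroup (coeff (shift 2 (freePoly n)) k) (coeff (shift 1 (afterRightPoly n)) k) (coeff (shift 1 (freePoly n)) k)
  where
  regroup : ∀ a b c → a ℤ.+ (a ℤ.+ (a ℤ.+ (a ℤ.+ (b ℤ.+ (c ℤ.+ 0ℤ))))) ≡ + 4 ℤ.* a ℤ.+ b ℤ.+ c
  regroup = solve-∀

shift₁-afterRightPoly : ∀ n k → coeff (shift 1 (afterRightPoly (suc n))) k ≡ coeff (shift 1 (freePoly (suc n))) k ℤ.- coeff (shift 2 (freePoly n)) k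
shift₁-afterRightPoly n zero    = refl
shift₁-afterRightPoly n (suc k) rewrite freePoly-afterRightPoly n k = cancel (coeff (afterRightPoly (suc n)) k) (coeff (shift 1 (freePoly n)) k)
  where
  cancel : ∀ b a → b ≡ b ℤ.+ a ℤ.- a
  cancel = solve-∀

freePoly-recurrence : ∀ n k → coeff (freePoly (suc (suc n))) k ≡
  + 4 ℤ.* coeff (shift 2 (freePoly (suc n))) k ℤ.+ + 2 ℤ.* coeff (shift 1 (freePoly (suc n))) k ℤ.- coeff (shift 2 (freePoly n)) k
freePoly-recurrence n k rewrite freePoly-step (suc n) k | shift₁-afterRightPoly n k =
  regroup (coeff (shift 2 (freePoly (suc n))) k) (coeff (shift 1 (freePoly (suc n))) k) (coeff (shift 2 (freePoly n)) k)
  where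
  regroup : ∀ a b c → + 4 ℤ.* a ℤ.+ (b ℤ.- c) ℤ.+ b ≡ + 4 ℤ.* a ℤ.+ + 2 ℤ.* b ℤ.- c
  regroup = solve-∀

shift-cong : ∀ m {p q} → p ≈ q → shift m p ≈ shift m q
shift-cong zero    p≈q k       = p≈q k
shift-cong (suc m) p≈q zero    = refl
shift-cong (suc m) p≈q (suc k) = shift-cong m p≈q k

coeff-quadratic : ∀ a b c p k → coeff ((a ∷ b ∷ c ∷ []) ⊗ p) k ≡
  a ℤ.* coeff p k ℤ.+ (b ℤ.* coeff (shift 1 p) k ℤ.+ c ℤ.* coeff (shift 2 p) k)
coeff-quadratic a b c p zero = trans (coeff-∷⊗ a (b ∷ c ∷ []) p 0)
  (cong (ℤ._+_ (a ℤ.* coeff p 0)) (zeros b c))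
  where
  zeros : ∀ b c → 0ℤ ≡ b ℤ.* 0ℤ ℤ.+ c ℤ.* 0ℤ
  zeros = solve-∀
coeff-quadratic a b c p (suc zero) = trans (coeff-∷⊗ a (b ∷ c ∷ []) p 1)
  (cong (ℤ._+_ (a ℤ.* coeff p 1)) (trans (coeff-∷⊗ b (c ∷ []) p 0)
    (cong (ℤ._+_ (b ℤ.* coeff p 0)) (sym (ℤ.*-zeroʳ c)))))
coeff-quadratic a b c p (suc (suc k)) = trans (coeff-∷⊗ a (b ∷ c ∷ []) p (suc (suc k)))
  (cong (ℤ._+_ (a ℤ.* coeff p (suc (suc k)))) (trans (coeff-∷⊗ b (c ∷ []) p (suc k))
    (cong (ℤ._+_ (b ℤ.* coeff p (suc k))) (trans (coeff-∷⊗ c [] p k)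
      (trans (cong (ℤ._+_ (c ℤ.* coeff p k)) (shift-[] 1 k)) (ℤ.+-identityʳ _))))))

quadratic-recurrence : ∀ {a b c a′ b′ c′} → a ≈ a′ → b ≈ b′ → c ≈ c′ →
  (∀ k → coeff a′ k ≡ + 4 ℤ.* coeff (shift 2 b′) k ℤ.+ + 2 ℤ.* coeff (shift 1 b′) k ℤ.- coeff (shift 2 c′) k) →
  a ≈ (+ 4 · x^ 2 ⊕ + 2 · x^ 1) ⊗ b ⊖ x^ 2 ⊗ c
quadratic-recurrence {a} {b} {c} {a′} {b′} {c′} a≈ b≈ c≈ rec k
  rewrite coeff-⊖ ((+ 4 · x^ 2 ⊕ + 2 · x^ 1) ⊗ b) (x^ 2 ⊗ c) k
        | coeff-quadratic 0ℤ (+ 2) (+ 4) b k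
        | coeff-quadratic 0ℤ 0ℤ 1ℤ c k
        | shift-cong 1 {b} {b′} b≈ k
        | shift-cong 2 {b} {b′} b≈ k
        | shift-cong 2 {c} {c′} c≈ k
        | a≈ k | rec k =
  regroup (coeff (shift 2 b′) k) (coeff (shift 1 b′) k) (coeff (shift 2 c′) k)
          (coeff b k) (coeff c k) (coeff (shift 1 c) k)
  where
  regroup : ∀ a b c d e f → + 4 ℤ.* a ℤ.+ + 2 ℤ.* b ℤ.- c ≡
    0ℤ ℤ.* d ℤ.+ (+ 2 ℤ.* b ℤ.+ + 4 ℤ.* a) ℤ.- (0ℤ ℤ.* e ℤ.+ (0ℤ ℤ.* f ℤ.+ 1ℤ ℤ.* c))
  regroup = solve-∀

F-recurrence : ∀ n → F (H (suc (suc n))) ≈ (+ 4 · x^ 2 ⊕ + 2 · x^ 1) ⊗ F (H (suc n)) ⊖ x^ 2 ⊗ F (H n)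
F-recurrence n = quadratic-recurrence
  {F (H (suc (suc n)))} {F (H (suc n))} {F (H n)} {freePoly (suc (suc n))} {freePoly (suc n)} {freePoly n}
  (F≈wordPoly (suc (suc n))) (F≈wordPoly (suc n)) (F≈wordPoly n) (freePoly-recurrence n)

theorem3p1 : (F (H 0) ≈ x^ 0)
    × (F (H 1) ≈ + 4 · x^ 2 ⊕ + 2 · x^ 1)
    × (∀ (n : ℕ) → 2 ≤ n →
    F (H n) ≈ (+ 4 · x^ 2 ⊕ + 2 · x^ 1) ⊗ F (H (n ∸ 1)) ⊖ x^ 2 ⊗ F (H (n ∸ 2)))
theorem3p1 = (λ _ → refl) , F≈wordPoly 1 , λ { (suc (suc n)) (s≤s (s≤s _)) → F-recurrence n }
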